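{- The deterministic online algorithm PD-OMFLP for the Online Multi-Commodity Facility Location Problem has a competitive ratio of $O\left(\sqrt{|S|}\cdot\log n\right)$, where $S$ is the set of commodities and $n$ the number of requests.
   Context: Online Multi-Commodity Facility Location Problem (OMFLP). An instance consists of a finite metric space with point set $M$ and distance $d$, a finite set $S$ of commodities, construction costs $f_m^\sigma$ for all $m\in M$ and $\sigma\subseteq S$ (all known in advance), and a sequence of $n$ requests. Each request $r$ is located at a point of $M$ and demands a set $s_r\subseteq S$; $d(m,r)$ denotes the distance from $m\in M$ to the location of $r$. A solution opens facilities, each at a point $m\in M$ with a configuration $\sigma\subseteq S$ (the set of commodities it offers), at cost $f_m^\sigma$; several facilities may be opened at the same point. Each request $r$ is assigned to a set of open facilities that jointly offer all commodities of $s_r$, at assignment cost equal to the sum of the distances from $r$ to these facilities. The total cost is the sum of all construction and assignment costs. Requests are revealed one by one; on arrival a request must immediately be assigned, where the algorithm may first open new facilities; all decisions are irrevocable. Standing assumptions on the costs: (i) subadditivity: for every $m\in M$, every $\sigma\subseteq S$ and all $a,b\subseteq\sigma$ with $a\cup b=\sigma$, $f_m^\sigma\le f_m^a+f_m^b$; (ii) $f_m^\sigma/|\sigma|\ge f_m^S/|S|$ for all $m\in M$ and all nonempty $\sigma\subseteq S$. Competitive ratio: an online algorithm is $c$-competitive if there is a constant $a$, independent of the instance, such that on every instance its cost is at most $c\cdot\mathrm{OPT}+a$, where OPT is the optimal offline cost. Algorithm PD-OMFLP. A facility is small if its configuration is a singleton $\{e\}$ and large if its configuration is $S$. At any time, $F(e)$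 is the set of currently open facilities offering $e$, and $\hat F$ the set of currently open large facilities; $d(G,r)$ is the distance from $r$ to the closest facility of $G$ ($\infty$ if $G=\emptyset$); $(a)_+=\max\{a,0\}$. When a request $r$ arrives, let $R$ be the set of requests that arrived earlier (their values $a_{je}$, $e\in s_j$, are already fixed). Start with $a_{re}=0$ and all $e\in s_r$ unserved, and simultaneously increase all $a_{re}$ with $e\in s_r$ unserved, while respecting the constraints (1) $a_{re}\le d(F(e),r)$ for all $e\in s_r$; (2) $\sum_{e\in s_r}a_{re}\le d(\hat F,r)$; (3) $(a_{re}-d(m,r))_+ +\sum_{j\in R:\,e\in s_j}(\min\{a_{je},d(F(e),j)\}-d(m,j))_+\le f_m^{\{e\}}$ for all $e\in s_r$, $m\in M$; (4) $\left(\sum_{e\in s_r}a_{re}-d(m,r)\right)_+ +\sum_{j\in R}\left(\min\{\sum_{e\in s_j}a_{je},d(\hat F,j)\}-d(m,j)\right)_+\le f_m^S$ for all $m\in M$. If (1) or (3) becomes tight for an unserved $e$ (with $m$ the location of the closest facility in $F(e)$, resp. the point $m$ in (3)), freeze $a_{re}$ and declare $e$ served by $m$; in case (3) also declare a small facility with configuration $\{e\}$ at $m$ temporarily open. If (2) or (4) becomes tight (with $m$ the location of the closest large facility, resp. the point $m$ in (4)), freeze $a_{re'}$ for all $e'\in s_r$, declare all $e'\in s_r$ served by the large facility at $m$, and remove all temporarily open facilities; in case (4) open a large facility at $m$. The process ends when all $e\in s_r$ are served; then all remaining temporarily open facilities are opened and $r$ is assigned to the facilities serving its commodities.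
   Formalization: The formal statement adds the assumption that a facility offering only e costs at most as much as any facility at the same point whose configuration contains e; without it the claim fails (one point, f^{1,2}=1, f^S=|S|/2, all other costs |S|, two requests for commodity 1). -}

module Defs where

open import Level using (_⊔_) renaming (suc to lsuc)
open import Algebra.Bundles using (CommutativeRing)
open import Algebra.Core using (Op₁; Op₂)
import Algebra.Construct.NaturalChoice.Max as Max
import Algebra.Construct.NaturalChoice.Min as Min
import Algebra.Properties.Monoid.Mult as Mult
import Algebra.Properties.CommutativeMonoid.Sum as Sum
open import Algebra.Structures using (IsCommutativeRing)
open import Data.Bool using (Bool; true; false; if_then_else_; _∧_)
import Data.Bool.Properties as Bool
open import Data.Fin using (Fin)
open import Data.Fin.Subset
  using (Subset; _∈_; _∪_; _⊆_; ∣_∣; Nonempty; ⁅_⁆; ⋃)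
  renaming (⊤ to full; ⊥ to none)
open import Data.Fin.Subset.Properties using (_∈?_)
open import Data.List using (List; []; _∷_; foldr; filter; map; mapMaybe; allFin; length)
open import Data.Maybe using (Maybe; just; nothing)
open import Data.Nat as ℕ using (ℕ; zero; suc)
open import Data.Product using (∃; _×_; _,_)
open import Data.Vec as Vec using (Vec; []; _∷_; _++_; lookup; toList; fromList)
open import Data.Vec.Functional using (Vector; updateAt)
open import Data.Vec.Properties using (≡-dec)
open import Function using (const; _∘_)
open import Function.Metric.Structures using (IsGeneralMetric)
open import Relation.Binary.Bundles using (DecTotalOrder)
open import Relation.Binary.Core using (Rel)
import Relation.Binary.Construct.Add.Supremum.Equality as Equality⁺
import Relation.Binary.Construct.Add.Supremum.NonStrict as Order⁺
open import Relation.Binary.PropositionalEquality using (_≡_; _≢_)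
open import Relation.Binary.Structures using (IsDecTotalOrder)
open import Relation.Nullary using (¬_)
open import Relation.Nullary.Construct.Add.Supremum using (_⁺; [_]; ⊤⁺)

-- The scalars.  Classically ℝ is an instance (as is ℚ), so a statement about
-- all ordered fields contains the one about real distances and costs.
record OrderedField c ℓ₁ ℓ₂ : Set (lsuc (c ⊔ ℓ₁ ⊔ ℓ₂)) where
  infix  8 _⁻¹ -_
  infixl 7 _*_ _/_
  infixl 6 _+_
  infix  4 _≈_ _≤_
  field
    Carrier           : Set c
    _≈_               : Rel Carrier ℓ₁
    _≤_               : Rel Carrier ℓ₂
    _+_ _*_           : Op₂ Carrier
    -_ _⁻¹            : Op₁ Carrier
    0# 1#             : Carrier
    isCommutativeRing : IsCommutativeRing _≈_ _+_ _*_ -_ 0# 1#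
    isDecTotalOrder   : IsDecTotalOrder _≈_ _≤_
    0≉1               : ¬ 0# ≈ 1#
    *-inverseʳ        : ∀ {x} → ¬ x ≈ 0# → x * x ⁻¹ ≈ 1#
    +-monoʳ-≤         : ∀ x {y z} → y ≤ z → x + y ≤ x + z
    *-nonNegative     : ∀ {x y} → 0# ≤ x → 0# ≤ y → 0# ≤ x * y

  commutativeRing : CommutativeRing c ℓ₁
  commutativeRing = record { isCommutativeRing = isCommutativeRing }

  decTotalOrder : DecTotalOrder c ℓ₁ ℓ₂
  decTotalOrder = record { isDecTotalOrder = isDecTotalOrder }

  open CommutativeRing commutativeRing public using (_-_)
  open CommutativeRing commutativeRing using (+-commutativeMonoid; +-monoid)

  open Min (DecTotalOrder.totalOrder decTotalOrder) public using () renaming (_⊓_ to min)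
  open Max (DecTotalOrder.totalOrder decTotalOrder) public using () renaming (_⊔_ to max)
  open Mult +-monoid using () renaming (_×_ to _·_)
  open Sum +-commutativeMonoid public using (sum)
  open Equality⁺ _≈_ public using (_≈⁺_)
  open Order⁺ _≤_ public using (_≤⁺_)

  fromℕ : ℕ → Carrier
  fromℕ n = n · 1#

  _/_ : Carrier → ℕ → Carrier
  x / n = x * fromℕ n ⁻¹

  _₊ : Carrier → Carrier
  x ₊ = max x 0#

  min⁺ : Carrier → Carrier ⁺ → Carrier
  min⁺ x [ y ] = min x y
  min⁺ x ⊤⁺    = x

  sumOver : ∀ {n} → Subset n → Vector Carrier n → Carrier
  sumOver A g = sum (λ i → if lookup A i then g i else 0#)

  -- A general ordered field has neither square roots nor logarithms, so both
  -- enter through their upper bounds.  Over ℝ the least s with √ n ≤√ s is √n,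
  -- and the least l with log₂ n ≤ l is log₂ n, the supremum of the p/q with
  -- 2ᵖ ≤ nᑫ.

  √_⊑_ : ℕ → Carrier → Set ℓ₂
  √ n ⊑ s = 0# ≤ s × fromℕ n ≤ s * s

  log₂_⊑_ : ℕ → Carrier → Set ℓ₂
  log₂ n ⊑ l = ∀ p q → 2 ℕ.^ p ℕ.≤ n ℕ.^ q → fromℕ p ≤ fromℕ q * l

  infix 4 √_⊑_ log₂_⊑_

record Environment {c ℓ₁ ℓ₂} (K : OrderedField c ℓ₁ ℓ₂) : Set (c ⊔ ℓ₁ ⊔ ℓ₂) where
  open OrderedField K
  field
    ∣M∣ ∣S∣ : ℕ

  Point : Set
  Point = Fin ∣M∣

  Commodity : Set
  Commodity = Fin ∣S∣

  Configuration : Set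
  Configuration = Subset ∣S∣

  field
    d           : Point → Point → Carrier
    isMetric    : IsGeneralMetric _≡_ _≈_ _≤_ 0# _+_ d
    f           : Point → Configuration → Carrier
    -- With a = b = σ this also makes the costs nonnegative.
    subadditive : ∀ m {σ a b} → a ⊆ σ → b ⊆ σ → a ∪ b ≡ σ → f m σ ≤ f m a + f m b
    average     : ∀ m {σ} → Nonempty σ → f m full / ∣S∣ ≤ f m σ / ∣ σ ∣
    -- A facility may not become cheaper than a singleton by offering more.
    -- This does not follow from the two conditions above, and the guarantee
    -- needs it: on a single point, with |S| ≥ 3, let f {1,2} = 1, f S = |S|/2
    -- and f σ = |S| otherwise.  For two requests of {1} the algorithm pays |S|/2, OPT pays 1.
    singleton   : ∀ m {σ e} → e ∈ σ → f m ⁅ e ⁆ ≤ f m σ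

module OMFLP {c ℓ₁ ℓ₂} {K : OrderedField c ℓ₁ ℓ₂} (E : Environment K) where
  open OrderedField K
  open Environment E

  record Request : Set where
    field
      location : Point
      demand   : Configuration

  record Facility : Set where
    constructor ⟨_,_⟩
    field
      site   : Point
      config : Configuration

  open Request public
  open Facility public

  -- Facilities are told apart by their index, so a point may carry several.
  record Solution (n : ℕ) : Set where
    field
      {size}     : ℕ
      facilities : Vec Facility size
      assigned   : Vec (Subset size) n

  open Solution public

  Feasible : ∀ {n} → Vec Request n → Solution n → Set
  Feasible rs σ = ∀ j {e} → e ∈ demand (lookup rs j) →
    ∃ λ i → i ∈ lookup (assigned σ) j × e ∈ config (lookup (facilities σ) i)

  assignmentCost : ∀ {N} → Vec Facility N → Request → Subset N → Carrier
  assignmentCost F r A = sumOver A (λ i → d (site (lookup F i)) (location r))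

  cost : ∀ {n} → Vec Request n → Solution n → Carrier
  cost rs σ =
      sum (λ i → f (site (lookup (facilities σ) i)) (config (lookup (facilities σ) i)))
    + sum (λ j → assignmentCost (facilities σ) (lookup rs j) (lookup (assigned σ) j))

  dist : List Facility → Point → Carrier ⁺
  dist G p = foldr (λ φ δ → [ min⁺ (d (site φ) p) δ ]) ⊤⁺ G

  Duals : Set c
  Duals = Vector Carrier ∣S∣

  total : Request → Duals → Carrier
  total r a = sumOver (demand r) a

  data Status (N : ℕ) : Set where
    unserved : Status N
    existing : Fin N → Status N
    temp     : Point → Status N

  isUnserved : ∀ {N} → Status N → Bool
  isUnserved unserved     = true
  isUnserved (existing _) = false
  isUnserved (temp _)     = false

  -- The decisions made for one request: its dual values, the facilities opened
  -- earlier that it is assigned to, and the facilities opened for it, all of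
  -- which it is assigned to.
  record Outcome (N : ℕ) : Set c where
    constructor outcome
    field
      duals  : Duals
      reused : Subset N
      opened : List Facility

  open Outcome public

  -- Arrival of r after the requests rs with duals α, when F is open.  The
  -- temporary facilities need not be counted in F: one with configuration {e}
  -- could only affect constraints (1) and (3) for e, and e is then already
  -- frozen.
  module Arrival {n N} (rs : Vec Request n) (α : Vec Duals n)
                 (F : Vec Facility N) (r : Request) where

    offering : Commodity → List Facility
    offering e = filter (λ φ → e ∈? config φ) (toList F)

    large : List Facility
    large = filter (λ φ → ≡-dec Bool._≟_ (config φ) full) (toList F)

    smallBids : Commodity → Point → Carrier
    smallBids e m = sum (λ j → if lookup (demand (lookup rs j)) e then bid j else 0#)
      where
      bid : Fin n → Carrier
      bid j = (min⁺ (lookup α j e) (dist (offering e) (location (lookup rs j)))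
               - d m (location (lookup rs j))) ₊

    largeBids : Point → Carrier
    largeBids m = sum (λ j →
      (min⁺ (total (lookup rs j) (lookup α j)) (dist large (location (lookup rs j)))
       - d m (location (lookup rs j))) ₊)

    record Respected (a : Duals) : Set (c ⊔ ℓ₂) where
      field
        constraint₁ : ∀ {e} → e ∈ demand r → [ a e ] ≤⁺ dist (offering e) (location r)
        constraint₂ : [ total r a ] ≤⁺ dist large (location r)
        constraint₃ : ∀ {e} → e ∈ demand r → ∀ m →
                      (a e - d m (location r)) ₊ + smallBids e m ≤ f m ⁅ e ⁆
        constraint₄ : ∀ m → (total r a - d m (location r)) ₊ + largeBids m ≤ f m full

    -- The index i is that of a closest facility, whose distance the duals reach.

    Tight₁ : Duals → Commodity → Fin N → Set (c ⊔ ℓ₁)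
    Tight₁ a e i = e ∈ config (lookup F i)
                 × [ d (site (lookup F i)) (location r) ] ≈⁺ dist (offering e) (location r)
                 × [ a e ] ≈⁺ dist (offering e) (location r)

    Tight₂ : Duals → Fin N → Set (c ⊔ ℓ₁)
    Tight₂ a i = config (lookup F i) ≡ full
               × [ d (site (lookup F i)) (location r) ] ≈⁺ dist large (location r)
               × [ total r a ] ≈⁺ dist large (location r)

    -- A constraint is tight when it forbids any further increase.  Equality
    -- alone is weaker: while a e is below d(m,r), constraint (3) can be an
    -- equality through the earlier bids alone (or because f m ⁅ e ⁆ is 0)
    -- without limiting a e.

    Tight₃ : Duals → Commodity → Point → Set (ℓ₁ ⊔ ℓ₂)
    Tight₃ a e m = d m (location r) ≤ a e
                 × (a e - d m (location r)) ₊ + smallBids e m ≈ f m ⁅ e ⁆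

    Tight₄ : Duals → Point → Set (ℓ₁ ⊔ ℓ₂)
    Tight₄ a m = d m (location r) ≤ total r a
               × (total r a - d m (location r)) ₊ + largeBids m ≈ f m full

    Statuses : Set
    Statuses = Commodity → Status N

    Pending : Statuses → Commodity → Set
    Pending st e = e ∈ demand r × st e ≡ unserved

    raise : Carrier → Statuses → Duals → Duals
    raise t st a e = if lookup (demand r) e ∧ isUnserved (st e) then a e + t else a e

    reusedBy : Status N → Subset N
    reusedBy (existing i) = ⁅ i ⁆
    reusedBy _            = none

    openedFor : Statuses → Commodity → Maybe Facility
    openedFor st e with st e
    ... | temp m = just ⟨ m , ⁅ e ⁆ ⟩
    ... | _      = nothing

    -- Continuous growth is cut into finitely many rises.  The left-hand sides of
    -- the constraints are monotone in the duals, so a rise respects them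
    -- throughout as soon as its end point does, and a positive rise cannot pass
    -- a tight constraint.  Simultaneous events may be handled in any order.
    data Process (a : Duals) (st : Statuses) : Outcome N → Set (c ⊔ ℓ₁ ⊔ ℓ₂) where
      rise   : ∀ {o} t → 0# ≤ t → Respected (raise t st a) →
               Process (raise t st a) st o → Process a st o
      event₁ : ∀ {o} e i → Pending st e → Tight₁ a e i →
               Process a (updateAt st e (const (existing i))) o → Process a st o
      event₃ : ∀ {o} e m → Pending st e → Tight₃ a e m →
               Process a (updateAt st e (const (temp m))) o → Process a st o
      event₂ : ∀ i → ∃ (Pending st) → Tight₂ a i →
               Process a st (outcome a ⁅ i ⁆ [])
      event₄ : ∀ m → ∃ (Pending st) → Tight₄ a m →
               Process a st (outcome a none (⟨ m , full ⟩ ∷ []))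
      finish : ¬ ∃ (Pending st) →
               Process a st (outcome a (⋃ (map (reusedBy ∘ st) (allFin ∣S∣)))
                                       (mapMaybe (openedFor st) (allFin ∣S∣)))

    Served : Outcome N → Set (c ⊔ ℓ₁ ⊔ ℓ₂)
    Served = Process (const 0#) (const unserved)

  extend : ∀ {n} (σ : Solution n) → Outcome (size σ) → Solution (suc n)
  extend σ o = record
    { facilities = facilities σ ++ fromList (opened o)
    ; assigned   = (reused o ++ full) ∷ Vec.map (_++ none) (assigned σ)
    }

  -- Request sequences list the latest arrival first, so that a run on r ∷ rs
  -- is a run on rs, whose decisions are kept, followed by the arrival of r.
  data PD-OMFLP : ∀ {n} → Vec Request n → Vec Duals n → Solution n → Set (c ⊔ ℓ₁ ⊔ ℓ₂) where
    start  : PD-OMFLP [] [] (record { facilities = [] ; assigned = [] })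
    arrive : ∀ {n} {rs : Vec Request n} {α σ} r {o} → PD-OMFLP rs α σ →
             Arrival.Served rs α (facilities σ) r o →
             PD-OMFLP (r ∷ rs) (duals o ∷ α) (extend σ o)

module Submission where

-- Let T be the sum of all dual values a_je.
--
-- The algorithm pays at most 3 T.  The minima in constraints (3) and (4) make up
-- a potential: a new facility is paid for by the dual of the arriving request and
-- by bids, and opening it lowers the potential by at least these bids.
--
-- Conversely, T is compared with the facilities of τ one at a time.  For a single
-- commodity e (or for large facilities) and a point m, put x_j = a_j - d(m,j) and
-- let B be the cost of the facility at m.  Among k requests let i be the last to
-- arrive.  By (1) and the triangle inequality a_i <= d(F,j) + d(j,m) + d(m,i), so
-- j still bids at least min(x_j, x_i) - 2 d(m,j) when i arrives, and (3) gives
-- k min x <= B + 2 sum d(m,j).  Removing the minimum and repeating, the sum of the x_j is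
-- at most H_k (B + 2 sum d(m,j)), where H_k = O(log n).  A configuration with at
-- most √|S| commodities is charged commodity by commodity, a larger one is
-- compared with S through the averaging condition; either way √|S| is lost.

open import Defs
open import Level using (_⊔_)
open import Algebra.Bundles using (CommutativeRing)
import Algebra.Construct.NaturalChoice.Max as Max
import Algebra.Construct.NaturalChoice.Min as Min
import Algebra.Properties.CommutativeMonoid.Sum as SumProperties
import Algebra.Properties.Ring as RingProperties
import Algebra.Properties.Semiring.Mult as SemiringMult
import Algebra.Solver.Ring.NaturalCoefficients.Default as SemiringSolver
open import Data.Bool using (Bool; true; false; if_then_else_; _∧_; _∨_)
import Data.Bool.Properties as Bool
open import Data.Empty using (⊥-elim)
open import Data.Fin using (Fin; zero; suc)
open import Data.Fin.Properties using (_≟_)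
open import Data.Fin.Subset using (Subset; _∈_; _∪_; ∣_∣; Nonempty; ⁅_⁆; ⋃) renaming (⊤ to full; ⊥ to none)
open import Data.Fin.Subset.Properties using (_∈?_; x∈⁅x⁆; nonempty?; Empty-unique; ∣⊥∣≡0; ∣p∣≤n; ∪-idem)
open import Data.List as List using (List; []; _∷_; length; map; mapMaybe; allFin; filter)
import Data.List.Membership.Propositional as List
open import Data.List.Membership.Propositional.Properties using (∈-filter⁺; ∈-filter⁻; ∈-++⁺ˡ; ∈-++⁺ʳ; ∈-allFin)
open import Data.List.Relation.Binary.Sublist.Propositional using (_⊆_; []; _∷_; _∷ʳ_; ⊆-refl)
open import Data.List.Relation.Unary.All as All using (All; []; _∷_)
open import Data.List.Relation.Unary.Any as Any using (here; there)
import Data.List.Relation.Unary.Any.Properties as Any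
open import Data.Maybe using (Maybe; just; nothing; maybe)
import Data.Maybe.Relation.Unary.Any as Maybe
open import Data.Nat as ℕ using (ℕ; zero; suc) renaming (_≤_ to _≤ⁿ_)
import Data.Nat.Properties as ℕ
open import Data.Product using (∃; _×_; _,_; proj₁)
open import Data.Sum using (_⊎_; inj₁; inj₂)
open import Data.Vec as Vec using (Vec; []; _∷_; lookup; toList; fromList; _++_)
open import Data.Vec.Functional using (updateAt)
open import Data.Vec.Functional.Properties using (updateAt-updates; updateAt-minimal)
open import Data.Vec.Properties using ([]=⇒lookup; lookup⇒[]=; toList-++; toList∘fromList; lookup-map; ≡-dec)
open import Function using (_∘_; const)
open import Function.Metric.Structures using (IsGeneralMetric)
open import Relation.Binary.Bundles using (DecTotalOrder)
open import Relation.Binary.Construct.Add.Point.Equality using ([_])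
open import Relation.Binary.Construct.Add.Supremum.NonStrict using ([_]; _≤⊤⁺)
open import Relation.Binary.PropositionalEquality as ≡ using (_≡_; cong; subst)
import Relation.Binary.Reasoning.PartialOrder as PosetReasoning
open import Relation.Nullary using (¬_; yes; no)
open import Relation.Nullary.Construct.Add.Supremum using ([_]; ⊤⁺)

-- Sublists cut out by a Boolean mask

select : ∀ {a} {A : Set a} {n} → (Fin n → Bool) → (Fin n → A) → List A
select {n = zero}  s g = []
select {n = suc n} s g = if s zero then g zero ∷ rest else rest
  where rest = select (s ∘ suc) (g ∘ suc)

length-select : ∀ {a} {A : Set a} {n} (s : Fin n → Bool) (g : Fin n → A) → length (select s g) ≤ⁿ n
length-select {n = zero}  s g = ℕ.z≤n
length-select {n = suc n} s g with s zero
... | true  = ℕ.s≤s (length-select (s ∘ suc) (g ∘ suc))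
... | false = ℕ.m≤n⇒m≤1+n (length-select (s ∘ suc) (g ∘ suc))

-- Ordered fields

module OrderedFieldProperties {c ℓ₁ ℓ₂} (K : OrderedField c ℓ₁ ℓ₂) where
  open OrderedField K
  open CommutativeRing commutativeRing public
    using ( refl; sym; trans; reflexive; +-cong; +-congˡ; +-congʳ; +-comm; +-assoc; +-identityˡ
          ; +-identityʳ; *-congˡ; *-congʳ; *-comm; *-assoc; *-identityˡ; *-identityʳ
          ; zeroˡ; zeroʳ; distribˡ; distribʳ; -‿inverseˡ; -‿inverseʳ)
  open CommutativeRing commutativeRing
    using (commutativeSemiring; -‿cong; ring; +-commutativeMonoid)
  open DecTotalOrder decTotalOrder public using (poset)
    renaming (total to ≤-total; refl to ≤-refl; trans to ≤-trans; antisym to ≤-antisym; reflexive to ≤-reflexive)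
  open RingProperties ring using (-‿distribˡ-*; -‿involutive)
  open SumProperties +-commutativeMonoid public using (sum-replicate-zero; ∑-distrib-+; ∑-comm)
    renaming (sum-cong-≋ to sum-cong)
  open Min (DecTotalOrder.totalOrder decTotalOrder) public using ()
    renaming (x⊓y≤x to min≤ˡ; x⊓y≤y to min≤ʳ; ⊓-glb to min-glb)
  open Max (DecTotalOrder.totalOrder decTotalOrder) public using ()
    renaming (x≤x⊔y to max≥ˡ; x≤y⊔x to max≥ʳ; ⊔-lub to ₊-lub)
  open SemiringSolver commutativeSemiring public using (Polynomial; solve; _:=_; _:+_; _:*_; con)
  module ≤-Reasoning = PosetReasoning poset

  +-mono-≤ : ∀ {x y u v} → x ≤ y → u ≤ v → x + u ≤ y + v
  +-mono-≤ {x} {y} {u} {v} x≤y u≤v = begin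
    x + u ≤⟨ +-monoʳ-≤ x u≤v ⟩
    x + v ≈⟨ +-comm x v ⟩
    v + x ≤⟨ +-monoʳ-≤ v x≤y ⟩
    v + y ≈⟨ +-comm v y ⟩
    y + v ∎
    where open ≤-Reasoning

  +-cancelʳ-≤ : ∀ {x y} z → x + z ≤ y + z → x ≤ y
  +-cancelʳ-≤ {x} {y} z x+z≤y+z = begin
    x                 ≈⟨ undo x ⟨
    x + z + - z       ≤⟨ +-mono-≤ x+z≤y+z ≤-refl ⟩
    y + z + - z       ≈⟨ undo y ⟩
    y                 ∎
    where
    open ≤-Reasoning
    undo : ∀ w → w + z + - z ≈ w
    undo w = trans (+-assoc w z (- z)) (trans (+-congˡ (-‿inverseʳ z)) (+-identityʳ w))

  -- Turns a linear inequality into a semiring identity, x ≤ y being the sum of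
  -- the hypotheses.
  linear : ∀ {x y u v} → x ≤ y → u + y ≈ v + x → u ≤ v
  linear {x} {y} {u} {v} x≤y eq =
    +-cancelʳ-≤ y (≤-trans (≤-reflexive eq) (+-monoʳ-≤ v x≤y))

  x-y+y≈x : ∀ x y → x - y + y ≈ x
  x-y+y≈x x y = trans (+-assoc x (- y) y) (trans (+-congˡ (-‿inverseˡ y)) (+-identityʳ x))

  x≤y⇒0≤y-x : ∀ {x y} → x ≤ y → 0# ≤ y - x
  x≤y⇒0≤y-x {x} {y} x≤y = ≤-trans (≤-reflexive (sym (-‿inverseʳ x))) (+-mono-≤ x≤y ≤-refl)

  x≤z+y⇒x-y≤z : ∀ {x y z} → x ≤ z + y → x - y ≤ z
  x≤z+y⇒x-y≤z {x} {y} p = +-cancelʳ-≤ y (≤-trans (≤-reflexive (x-y+y≈x x y)) p)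

  x-y≤z⇒x≤z+y : ∀ {x y z} → x - y ≤ z → x ≤ z + y
  x-y≤z⇒x≤z+y {x} {y} p = ≤-trans (≤-reflexive (sym (x-y+y≈x x y))) (+-mono-≤ p ≤-refl)

  x+y≤z⇒x≤z-y : ∀ {x y z} → x + y ≤ z → x ≤ z - y
  x+y≤z⇒x≤z-y {x} {y} {z} p = +-cancelʳ-≤ y (≤-trans p (≤-reflexive (sym (x-y+y≈x z y))))

  0≤x₊ : ∀ x → 0# ≤ x ₊
  0≤x₊ x = max≥ʳ x 0#

  +-nonNegative : ∀ {x y} → 0# ≤ x → 0# ≤ y → 0# ≤ x + y
  +-nonNegative 0≤x 0≤y = ≤-trans (≤-reflexive (sym (+-identityʳ 0#))) (+-mono-≤ 0≤x 0≤y)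

  x≤x+y : ∀ {x y} → 0# ≤ y → x ≤ x + y
  x≤x+y {x} 0≤y = ≤-trans (≤-reflexive (sym (+-identityʳ x))) (+-monoʳ-≤ x 0≤y)

  x≤y+x : ∀ {x y} → 0# ≤ y → x ≤ y + x
  x≤y+x {x} {y} 0≤y = ≤-trans (x≤x+y 0≤y) (≤-reflexive (+-comm x y))

  *-monoˡ-≤ : ∀ {x y z} → 0# ≤ z → x ≤ y → z * x ≤ z * y
  *-monoˡ-≤ {x} {y} {z} 0≤z x≤y = begin
    z * x               ≤⟨ x≤y+x (*-nonNegative 0≤z (x≤y⇒0≤y-x x≤y)) ⟩
    z * (y - x) + z * x ≈⟨ distribˡ z (y - x) x ⟨
    z * (y - x + x)     ≈⟨ *-congˡ (x-y+y≈x y x) ⟩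
    z * y               ∎
    where open ≤-Reasoning

  *-monoʳ-≤ : ∀ {x y z} → 0# ≤ z → x ≤ y → x * z ≤ y * z
  *-monoʳ-≤ {x} {y} {z} 0≤z x≤y =
    ≤-trans (≤-reflexive (*-comm x z)) (≤-trans (*-monoˡ-≤ 0≤z x≤y) (≤-reflexive (*-comm z y)))

  -- The axioms leave the sign of `1#` open: were `1#` nonpositive, it would still be the square of
  -- the nonnegative `- 1#`.
  0≤1 : 0# ≤ 1#
  0≤1 with ≤-total 0# 1#
  ... | inj₁ p = p
  ... | inj₂ 1≤0 = begin
    0#            ≤⟨ *-nonNegative 0≤-1 0≤-1 ⟩
    - 1# * - 1#   ≈⟨ -‿distribˡ-* 1# (- 1#) ⟨
    - (1# * - 1#) ≈⟨ -‿cong (*-identityˡ (- 1#)) ⟩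
    - (- 1#)      ≈⟨ -‿involutive 1# ⟩
    1#            ∎
    where
    open ≤-Reasoning
    0≤-1 : 0# ≤ - 1#
    0≤-1 = ≤-trans (x≤y⇒0≤y-x 1≤0) (≤-reflexive (+-identityˡ (- 1#)))

  0<1 : ¬ 1# ≤ 0#
  0<1 1≤0 = 0≉1 (≤-antisym 0≤1 1≤0)

  *-inverseˡ : ∀ {x} → ¬ x ≈ 0# → x ⁻¹ * x ≈ 1#
  *-inverseˡ {x} x≉0 = trans (*-comm (x ⁻¹) x) (*-inverseʳ x≉0)

  ⁻¹-nonNegative : ∀ {x} → 0# ≤ x → ¬ x ≈ 0# → 0# ≤ x ⁻¹
  ⁻¹-nonNegative {x} 0≤x x≉0 with ≤-total 0# (x ⁻¹)
  ... | inj₁ p = p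
  ... | inj₂ x⁻¹≤0 = ⊥-elim (0<1 (begin
    1#       ≈⟨ *-inverseʳ x≉0 ⟨
    x * x ⁻¹ ≤⟨ *-monoˡ-≤ 0≤x x⁻¹≤0 ⟩
    x * 0#   ≈⟨ zeroʳ x ⟩
    0#       ∎))
    where open ≤-Reasoning

  *-cancelˡ-≤ : ∀ {x y z} → 0# ≤ z → ¬ z ≈ 0# → z * x ≤ z * y → x ≤ y
  *-cancelˡ-≤ {x} {y} {z} 0≤z z≉0 zx≤zy = begin
    x              ≈⟨ undo x ⟨
    z ⁻¹ * (z * x) ≤⟨ *-monoˡ-≤ (⁻¹-nonNegative 0≤z z≉0) zx≤zy ⟩
    z ⁻¹ * (z * y) ≈⟨ undo y ⟩
    y              ∎
    where
    open ≤-Reasoning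
    undo : ∀ w → z ⁻¹ * (z * w) ≈ w
    undo w = trans (sym (*-assoc _ _ _)) (trans (*-congʳ (*-inverseˡ z≉0)) (*-identityˡ w))

  fromℕ-nonNegative : ∀ n → 0# ≤ fromℕ n
  fromℕ-nonNegative zero    = ≤-refl
  fromℕ-nonNegative (suc n) = +-nonNegative 0≤1 (fromℕ-nonNegative n)

  fromℕ-mono-≤ : ∀ {m n} → m ≤ⁿ n → fromℕ m ≤ fromℕ n
  fromℕ-mono-≤ {n = n} ℕ.z≤n = fromℕ-nonNegative n
  fromℕ-mono-≤ (ℕ.s≤s m≤n) = +-monoʳ-≤ 1# (fromℕ-mono-≤ m≤n)

  1≤fromℕ-suc : ∀ n → 1# ≤ fromℕ (suc n)
  1≤fromℕ-suc n = x≤x+y (fromℕ-nonNegative n)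

  fromℕ-suc≉0 : ∀ n → ¬ fromℕ (suc n) ≈ 0#
  fromℕ-suc≉0 n eq = 0<1 (≤-trans (1≤fromℕ-suc n) (≤-reflexive eq))

  suc-* : ∀ n x → fromℕ (suc n) * x ≈ x + fromℕ n * x
  suc-* n x = trans (distribʳ x _ _) (+-congʳ (*-identityˡ x))

  sum-mono : ∀ {n} {g h : Fin n → Carrier} → (∀ i → g i ≤ h i) → sum g ≤ sum h
  sum-mono {zero}  g≤h = ≤-refl
  sum-mono {suc n} g≤h = +-mono-≤ (g≤h zero) (sum-mono (g≤h ∘ suc))

  sum-zero : ∀ {n} {g : Fin n → Carrier} → (∀ i → g i ≈ 0#) → sum g ≈ 0#
  sum-zero {n} g≈0 = trans (sum-cong g≈0) (sum-replicate-zero n)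

  sum-nonNegative : ∀ {n} {g : Fin n → Carrier} → (∀ i → 0# ≤ g i) → 0# ≤ sum g
  sum-nonNegative {n} 0≤g = ≤-trans (≤-reflexive (sym (sum-replicate-zero n))) (sum-mono 0≤g)

  term≤sum : ∀ {n} (g : Fin n → Carrier) → (∀ i → 0# ≤ g i) → ∀ i → g i ≤ sum g
  term≤sum g 0≤g zero    = x≤x+y (sum-nonNegative (0≤g ∘ suc))
  term≤sum g 0≤g (suc i) = ≤-trans (term≤sum (g ∘ suc) (0≤g ∘ suc) i) (x≤y+x (0≤g zero))

  sum-+-≤ : ∀ {n} (g h : Fin n → Carrier) {k} → (∀ i → g i + h i ≤ k i) → sum g + sum h ≤ sum k
  sum-+-≤ g h {k} p = ≤-trans (≤-reflexive (sym (∑-distrib-+ g h))) (sum-mono {h = k} p)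

  sum-≤-+ : ∀ {n} (g h : Fin n → Carrier) {k} → (∀ i → k i ≤ g i + h i) → sum k ≤ sum g + sum h
  sum-≤-+ g h {k} p = ≤-trans (sum-mono {g = k} p) (≤-reflexive (∑-distrib-+ g h))

  *-distribˡ-sum : ∀ {n} x (g : Fin n → Carrier) → x * sum g ≈ sum (λ i → x * g i)
  *-distribˡ-sum {zero}  x g = zeroʳ x
  *-distribˡ-sum {suc n} x g = trans (distribˡ x _ _) (+-congˡ (*-distribˡ-sum x (g ∘ suc)))

  sumᴸ : ∀ {a} {A : Set a} → (A → Carrier) → List A → Carrier
  sumᴸ g []       = 0#
  sumᴸ g (p ∷ ps) = g p + sumᴸ g ps

  sumᴸ-⊆ : ∀ {a} {A : Set a} {g : A → Carrier} → (∀ p → 0# ≤ g p) → ∀ {ps qs} → ps ⊆ qs → sumᴸ g ps ≤ sumᴸ g qs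
  sumᴸ-⊆ 0≤g []              = ≤-refl
  sumᴸ-⊆ 0≤g (q ∷ʳ ps⊆qs)    = ≤-trans (sumᴸ-⊆ 0≤g ps⊆qs) (x≤y+x (0≤g q))
  sumᴸ-⊆ 0≤g (≡.refl ∷ ps⊆qs) = +-monoʳ-≤ _ (sumᴸ-⊆ 0≤g ps⊆qs)

  sumᴸ-select : ∀ {a} {A : Set a} {n} (h : A → Carrier) (s : Fin n → Bool) (g : Fin n → A) →
    sumᴸ h (select s g) ≈ sum (λ i → if s i then h (g i) else 0#)
  sumᴸ-select {n = zero}  h s g = refl
  sumᴸ-select {n = suc n} h s g with s zero
  ... | true  = +-congˡ (sumᴸ-select h (s ∘ suc) (g ∘ suc))
  ... | false = trans (sumᴸ-select h (s ∘ suc) (g ∘ suc)) (sym (+-identityˡ _))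

  if-mono : ∀ b {x y} → x ≤ y → (if b then x else 0#) ≤ (if b then y else 0#)
  if-mono true  x≤y = x≤y
  if-mono false _   = ≤-refl

  if-nonNegative : ∀ b {x} → 0# ≤ x → 0# ≤ (if b then x else 0#)
  if-nonNegative true  0≤x = 0≤x
  if-nonNegative false _   = ≤-refl

  if-+-≤ : ∀ b {x y z} → x + y ≤ z →
    (if b then x else 0#) + (if b then y else 0#) ≤ (if b then z else 0#)
  if-+-≤ true  p = p
  if-+-≤ false _ = ≤-reflexive (+-identityʳ 0#)

-- Harmonic numbers

-- By induction on `n`: the exponent stays the same until the upper bound is attained, and then
-- grows by one.
dyadic-floor : ∀ n → ∃ λ p → 2 ℕ.^ p ≤ⁿ suc n × suc (suc n) ≤ⁿ 2 ℕ.^ suc p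
dyadic-floor zero    = 0 , ℕ.≤-refl , ℕ.≤-refl
dyadic-floor (suc n) with dyadic-floor n
... | p , lower , upper with ℕ.m≤n⇒m<n∨m≡n upper
...   | inj₁ below = p , ℕ.m≤n⇒m≤1+n lower , below
...   | inj₂ equal = suc p , ℕ.≤-reflexive (≡.sym equal) ,
        subst (λ k → suc k ≤ⁿ 2 ℕ.^ suc (suc p)) (≡.sym equal)
          (ℕ.^-monoʳ-< 2 ℕ.≤-refl (ℕ.n<1+n (suc p)))

module HarmonicBounds {c ℓ₁ ℓ₂} (K : OrderedField c ℓ₁ ℓ₂) where
  open OrderedField K
  open OrderedFieldProperties K

  H : ℕ → Carrier
  H zero    = 0#
  H (suc k) = H k + fromℕ (suc k) ⁻¹

  fromℕ⁻¹-nonNegative : ∀ k → 0# ≤ fromℕ (suc k) ⁻¹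
  fromℕ⁻¹-nonNegative k = ⁻¹-nonNegative (fromℕ-nonNegative (suc k)) (fromℕ-suc≉0 k)

  H-nonNegative : ∀ k → 0# ≤ H k
  H-nonNegative zero    = ≤-refl
  H-nonNegative (suc k) = +-nonNegative (H-nonNegative k) (fromℕ⁻¹-nonNegative k)

  H-mono-≤ : ∀ {m n} → m ≤ⁿ n → H m ≤ H n
  H-mono-≤ {m} {n} m≤n with ℕ.m≤n⇒m<n∨m≡n m≤n
  ... | inj₂ ≡.refl = ≤-refl
  ... | inj₁ (ℕ.s≤s {n = k} m≤k) = ≤-trans (H-mono-≤ m≤k) (x≤x+y (fromℕ⁻¹-nonNegative k))

  ⁻¹-antitone : ∀ {j k} → j ≤ⁿ k → fromℕ (suc k) ⁻¹ ≤ fromℕ (suc j) ⁻¹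
  ⁻¹-antitone {j} {k} j≤k =
    *-cancelˡ-≤ (fromℕ-nonNegative (suc k)) (fromℕ-suc≉0 k) (begin
      fromℕ (suc k) * fromℕ (suc k) ⁻¹ ≈⟨ *-inverseʳ (fromℕ-suc≉0 k) ⟩
      1#                               ≈⟨ *-inverseʳ (fromℕ-suc≉0 j) ⟨
      fromℕ (suc j) * fromℕ (suc j) ⁻¹ ≤⟨ *-monoʳ-≤ (fromℕ⁻¹-nonNegative j) (fromℕ-mono-≤ (ℕ.s≤s j≤k)) ⟩
      fromℕ (suc k) * fromℕ (suc j) ⁻¹ ∎)
    where open ≤-Reasoning

  -- The first of the `j` added terms, 1/(k+1), is the largest.
  H-+ : ∀ k j → H (j ℕ.+ k) ≤ H k + fromℕ j * fromℕ (suc k) ⁻¹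
  H-+ k zero    = x≤x+y (≤-reflexive (sym (zeroˡ _)))
  H-+ k (suc j) = begin
    H (j ℕ.+ k) + fromℕ (suc (j ℕ.+ k)) ⁻¹ ≤⟨ +-mono-≤ (H-+ k j) (⁻¹-antitone (ℕ.m≤n+m k j)) ⟩
    H k + fromℕ j * i + i                  ≈⟨ solve 3 (λ h j i → h :+ j :* i :+ i := h :+ (i :+ j :* i)) refl (H k) (fromℕ j) i ⟩
    H k + (i + fromℕ j * i)                ≈⟨ +-congˡ (suc-* j i) ⟨
    H k + fromℕ (suc j) * i                ∎
    where
    open ≤-Reasoning
    i = fromℕ (suc k) ⁻¹

  -- Each doubling costs at most 1: the terms with denominators from 2ᵖ to 2ᵖ⁺¹ - 1 are 2ᵖ in
  -- number, and none exceeds 1/2ᵖ.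
  H-dyadic : ∀ p {k} → suc k ≡ 2 ℕ.^ p → H k ≤ fromℕ p
  H-dyadic zero    ≡.refl = ≤-refl
  H-dyadic (suc p) {k} eq = begin
    H k                                  ≡⟨ cong H k≡ ⟩
    H (suc k′ ℕ.+ k′)                    ≤⟨ H-+ k′ (suc k′) ⟩
    H k′ + fromℕ (suc k′) * fromℕ (suc k′) ⁻¹
                                         ≤⟨ +-mono-≤ (H-dyadic p k′≡) (≤-reflexive (*-inverseʳ (fromℕ-suc≉0 k′))) ⟩
    fromℕ p + 1#                         ≈⟨ +-comm _ _ ⟩
    1# + fromℕ p                         ∎
    where
    open ≤-Reasoning
    k′ = ℕ.pred (2 ℕ.^ p)
    k′≡ : suc k′ ≡ 2 ℕ.^ p
    k′≡ = ℕ.suc-pred (2 ℕ.^ p) {{ℕ.m^n≢0 2 p}}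
    k≡ : k ≡ suc k′ ℕ.+ k′
    k≡ = ℕ.suc-injective (≡.trans eq
      (≡.trans (≡.cong (λ z → z ℕ.+ (z ℕ.+ 0)) (≡.sym k′≡))
      (≡.trans (≡.cong (suc k′ ℕ.+_) (ℕ.+-identityʳ (suc k′))) (ℕ.+-suc (suc k′) k′))))

  module _ {n l} (2≤n : 2 ≤ⁿ n) (log≤l : log₂ n ⊑ l) where

    -- The instance 2¹ ≤ n¹ of the logarithm bound. It allows additive terms to be absorbed into
    -- multiples of `l`.
    1≤log : 1# ≤ l
    1≤log = begin
      1#               ≈⟨ +-identityʳ 1# ⟨
      fromℕ 1          ≤⟨ log≤l 1 1 (ℕ.≤-trans 2≤n (ℕ.≤-reflexive (≡.sym (ℕ.*-identityʳ n)))) ⟩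
      (1# + 0#) * l    ≈⟨ trans (*-congʳ (+-identityʳ 1#)) (*-identityˡ l) ⟩
      l                ∎
      where open ≤-Reasoning

    -- With 2ᵖ ≤ n < 2ᵖ⁺¹ the harmonic number is at most p + 1, and both p and 1 are at most `l`.
    H≤2log : H n ≤ l + l
    H≤2log with dyadic-floor (ℕ.pred n)
    ... | p , lower , upper = begin
      H n                     ≤⟨ H-mono-≤ (ℕ.≤-pred (ℕ.≤-trans (ℕ.≤-trans (ℕ.≤-reflexive (cong suc (≡.sym n≡))) upper) (ℕ.≤-reflexive (≡.sym e)))) ⟩
      H (ℕ.pred (2 ℕ.^ suc p)) ≤⟨ H-dyadic (suc p) e ⟩
      1# + fromℕ p            ≤⟨ +-mono-≤ 1≤log (log≤l p 1 (ℕ.≤-trans lower (ℕ.≤-reflexive (≡.trans n≡ (≡.sym (ℕ.*-identityʳ n)))))) ⟩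
      l + (1# + 0#) * l       ≈⟨ +-congˡ (trans (*-congʳ (+-identityʳ 1#)) (*-identityˡ l)) ⟩
      l + l                   ∎
      where
      open ≤-Reasoning
      n≡ : suc (ℕ.pred n) ≡ n
      n≡ = ℕ.suc-pred n {{ℕ.>-nonZero (ℕ.≤-trans (ℕ.s≤s ℕ.z≤n) 2≤n)}}
      e : suc (ℕ.pred (2 ℕ.^ suc p)) ≡ 2 ℕ.^ suc p
      e = ℕ.suc-pred (2 ℕ.^ suc p) {{ℕ.m^n≢0 2 (suc p)}}

-- Sums of charged bids

module Charging {c ℓ₁ ℓ₂} (K : OrderedField c ℓ₁ ℓ₂)
                {a} {A : Set a} (x δ : A → OrderedField.Carrier K) where
  open OrderedField K
  open OrderedFieldProperties K
  open HarmonicBounds K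

  -- Constraint (3) or (4) for a list of requests, latest first, with every earlier
  -- bid replaced by its lower bound.  The positive parts make it hereditary.
  data Charged (B : Carrier) : List A → Set (a ⊔ ℓ₂) where
    []  : Charged B []
    _∷_ : ∀ {p ps} → x p + sumᴸ (λ q → (min (x q) (x p) - (δ q + δ q)) ₊) ps ≤ B →
          Charged B ps → Charged B (p ∷ ps)

  Charged-⊆ : ∀ {B ps qs} → ps ⊆ qs → Charged B qs → Charged B ps
  Charged-⊆ []               _       = []
  Charged-⊆ (_ ∷ʳ ps⊆qs)     (_ ∷ c) = Charged-⊆ ps⊆qs c
  Charged-⊆ (≡.refl ∷ ps⊆qs) (h ∷ c) =
    ≤-trans (+-monoʳ-≤ _ (sumᴸ-⊆ (λ _ → 0≤x₊ _) ps⊆qs)) h ∷ Charged-⊆ ps⊆qs c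

  -- The remainder keeps the order of arrival and is a sublist, since this is what `Charged` is
  -- inherited by; sorting by surplus would destroy it.
  record Minimum (p : A) (ps : List A) : Set (a ⊔ ℓ₁ ⊔ ℓ₂) where
    field
      least  : A
      rest   : List A
      rest⊆  : rest ⊆ p ∷ ps
      length≡ : length rest ≡ length ps
      lower  : All (λ q → x least ≤ x q) (p ∷ ps)
      sum≈   : sumᴸ x (p ∷ ps) ≈ x least + sumᴸ x rest

  minimum : ∀ p ps → Minimum p ps
  minimum p []       = record
    { least = p ; rest = [] ; rest⊆ = p ∷ʳ [] ; length≡ = ≡.refl ; lower = ≤-refl ∷ [] ; sum≈ = refl }
  minimum p (q ∷ ps) with minimum q ps
  ... | m with ≤-total (x p) (x (Minimum.least m))
  ...   | inj₁ p≤m = record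
    { least = p ; rest = q ∷ ps ; rest⊆ = p ∷ʳ ⊆-refl ; length≡ = ≡.refl
    ; lower = ≤-refl ∷ All.map (≤-trans p≤m) (Minimum.lower m) ; sum≈ = refl }
  ...   | inj₂ m≤p = record
    { least = least ; rest = p ∷ rest ; rest⊆ = ≡.refl ∷ rest⊆ ; length≡ = cong suc length≡
    ; lower = m≤p ∷ lower
    ; sum≈ = trans (+-congˡ sum≈)
        (solve 3 (λ p m r → p :+ (m :+ r) := m :+ (p :+ r)) refl (x p) (x least) (sumᴸ x rest)) }
    where open Minimum m

  module _ (0≤δ : ∀ p → 0# ≤ δ p) {B D : Carrier} where

    private W = B + (D + D)

    -- Only the constraint of the head, the latest arrival, is used. Its own surplus is at least
    -- `b`, and every earlier request bids at least `b` minus twice its distance; moving the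
    -- distances to the right gives `D + D`.
    length*least≤ : ∀ {p ps} b → Charged B (p ∷ ps) → sumᴸ δ (p ∷ ps) ≤ D →
      All (λ q → b ≤ x q) (p ∷ ps) → fromℕ (suc (length ps)) * b ≤ W
    length*least≤ {p} {ps} b (charge ∷ _) δ≤D (b≤p ∷ b≤ps) = begin
      (1# + fromℕ (length ps)) * b          ≈⟨ suc-* (length ps) b ⟩
      b + fromℕ (length ps) * b             ≤⟨ +-mono-≤ b≤p (each ps b≤ps) ⟩
      x p + (sumᴸ bid ps + (Δ + Δ))         ≈⟨ +-assoc _ _ _ ⟨
      x p + sumᴸ bid ps + (Δ + Δ)           ≤⟨ +-mono-≤ charge (+-mono-≤ Δ≤D Δ≤D) ⟩
      B + (D + D)                           ∎
      where
      open ≤-Reasoning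
      bid : A → Carrier
      bid q = (min (x q) (x p) - (δ q + δ q)) ₊
      Δ = sumᴸ δ ps
      Δ≤D : Δ ≤ D
      Δ≤D = ≤-trans (x≤y+x (0≤δ p)) δ≤D
      each : ∀ qs → All (λ q → b ≤ x q) qs →
        fromℕ (length qs) * b ≤ sumᴸ bid qs + (sumᴸ δ qs + sumᴸ δ qs)
      each []       []           = ≤-reflexive (trans (zeroˡ b) (sym (trans (+-identityˡ _) (+-identityˡ 0#))))
      each (q ∷ qs) (b≤q ∷ b≤qs) = begin
        (1# + fromℕ (length qs)) * b   ≈⟨ suc-* (length qs) b ⟩
        -- A positive part is at least its argument, so `bid q + (δ q + δ q)` is at least the
        -- minimum of two surpluses that are both at least `b`.
        b + fromℕ (length qs) * b      ≤⟨ +-mono-≤ (≤-trans (min-glb b≤q b≤p) (x-y≤z⇒x≤z+y (max≥ˡ _ 0#))) (each qs b≤qs) ⟩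
        bid q + (δ q + δ q) + (sumᴸ bid qs + (sumᴸ δ qs + sumᴸ δ qs))
          ≈⟨ solve 4 (λ b d b′ d′ → b :+ (d :+ d) :+ (b′ :+ (d′ :+ d′)) := b :+ b′ :+ (d :+ d′ :+ (d :+ d′)))
               refl (bid q) (δ q) (sumᴸ bid qs) (sumᴸ δ qs) ⟩
        bid q + sumᴸ bid qs + (δ q + sumᴸ δ qs + (δ q + sumᴸ δ qs)) ∎

    -- The least of k + 1 surpluses is at most W/(k+1). Without it the list is still charged and has
    -- k members, so the bounds add up to a harmonic sum. The induction runs on the length because
    -- the remainder is not structurally smaller.
    charged-sum : ∀ k ps → length ps ≡ k → Charged B ps → sumᴸ δ ps ≤ D → sumᴸ x ps ≤ H k * W
    charged-sum zero    []       _  _  _   = ≤-reflexive (sym (zeroˡ W))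
    charged-sum (suc k) (p ∷ ps) eq ch δ≤D = begin
      x p + sumᴸ x ps         ≈⟨ sum≈ ⟩
      x least + sumᴸ x rest   ≤⟨ +-mono-≤ least≤ (charged-sum k rest (≡.trans length≡ (ℕ.suc-injective eq))
                                   (Charged-⊆ rest⊆ ch) (≤-trans (sumᴸ-⊆ 0≤δ rest⊆) δ≤D)) ⟩
      i * W + H k * W         ≈⟨ distribʳ W i (H k) ⟨
      (i + H k) * W           ≈⟨ *-congʳ (+-comm i (H k)) ⟩
      H (suc k) * W           ∎
      where
      open ≤-Reasoning
      open Minimum (minimum p ps)
      i = fromℕ (suc k) ⁻¹
      least≤ : x least ≤ i * W
      least≤ = *-cancelˡ-≤ (fromℕ-nonNegative (suc k)) (fromℕ-suc≉0 k) (begin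
        fromℕ (suc k) * x least  ≡⟨ cong (λ j → fromℕ j * x least) eq ⟨
        fromℕ (suc (length ps)) * x least ≤⟨ length*least≤ (x least) ch δ≤D lower ⟩
        W                        ≈⟨ trans (*-congʳ (*-inverseʳ (fromℕ-suc≉0 k))) (*-identityˡ W) ⟨
        fromℕ (suc k) * i * W    ≈⟨ *-assoc _ _ _ ⟩
        fromℕ (suc k) * (i * W)  ∎)

-- Distances to sets of facilities

module Distances {c ℓ₁ ℓ₂} {K : OrderedField c ℓ₁ ℓ₂} (E : Environment K) where
  open OrderedField K
  open OrderedFieldProperties K
  open Environment E
  open OMFLP E
  open IsGeneralMetric isMetric public using ()
    renaming (nonNegative to 0≤d; sym to d-sym; triangle to d-triangle)

  0≤f : ∀ m σ → 0# ≤ f m σ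
  0≤f m σ = +-cancelʳ-≤ (f m σ) (≤-trans (≤-reflexive (+-identityˡ _))
    (subadditive m (λ e∈ → e∈) (λ e∈ → e∈) (∪-idem σ)))

  min⁺≤ˡ : ∀ y D → min⁺ y D ≤ y
  min⁺≤ˡ y [ v ] = min≤ˡ y v
  min⁺≤ˡ y ⊤⁺    = ≤-refl

  min⁺≤ʳ : ∀ y D → [ min⁺ y D ] ≤⁺ D
  min⁺≤ʳ y [ v ] = [ min≤ʳ y v ]
  min⁺≤ʳ y ⊤⁺    = [ y ] ≤⊤⁺

  min⁺-glb : ∀ {x y D} → x ≤ y → [ x ] ≤⁺ D → x ≤ min⁺ y D
  min⁺-glb x≤y [ x≤v ]   = min-glb x≤y x≤v
  min⁺-glb x≤y ([ _ ] ≤⊤⁺) = x≤y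

  [≈]-unique : ∀ {x y D} → [ x ] ≈⁺ D → [ y ] ≈⁺ D → x ≈ y
  [≈]-unique [ x≈ ] [ y≈ ] = trans x≈ (sym y≈)

  -- Together with `dist-lower` this is the universal property of the infimum; the empty set of
  -- facilities has the infimum `⊤⁺`.
  dist-glb : ∀ {x p} G → (∀ {φ} → φ List.∈ G → x ≤ d (site φ) p) → [ x ] ≤⁺ dist G p
  dist-glb []      _ = _ ≤⊤⁺
  dist-glb (φ ∷ G) h = [ min⁺-glb (h (here ≡.refl)) (dist-glb G (h ∘ there)) ]

  dist-lower : ∀ {x p G φ} → [ x ] ≤⁺ dist G p → φ List.∈ G → x ≤ d (site φ) p
  dist-lower {p = p} {ψ ∷ G} [ x≤ ] (here ≡.refl) = ≤-trans x≤ (min⁺≤ˡ _ (dist G p))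
  dist-lower {x} {p} {ψ ∷ G} [ x≤ ] (there φ∈) =
    dist-lower (weaken (min⁺≤ʳ _ (dist G p))) φ∈
    where
    weaken : ∀ {D} → [ min⁺ (d (site ψ) p) (dist G p) ] ≤⁺ D → [ x ] ≤⁺ D
    weaken [ q ]        = [ ≤-trans x≤ q ]
    weaken ([ _ ] ≤⊤⁺) = _ ≤⊤⁺

  min⁺-dist≤ : ∀ y {p G φ} → φ List.∈ G → min⁺ y (dist G p) ≤ d (site φ) p
  min⁺-dist≤ y {p} {G} = dist-lower (min⁺≤ʳ y (dist G p))

  min⁺-dist-antitone : ∀ y p {G G′} → (∀ {φ} → φ List.∈ G → φ List.∈ G′) →
    min⁺ y (dist G′ p) ≤ min⁺ y (dist G p)
  min⁺-dist-antitone y p {G} {G′} G⊆G′ =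
    min⁺-glb (min⁺≤ˡ y (dist G′ p)) (dist-glb G (min⁺-dist≤ y ∘ G⊆G′))

  -- A bid is covered by the fall of the cap. The new cap is at most the distance to `φ` and at most
  -- the old cap, hence old minus new is at least both old minus distance and zero.
  min⁺-dist-bid : ∀ y p {G G′ φ} → (∀ {ψ} → ψ List.∈ G → ψ List.∈ G′) → φ List.∈ G′ →
    min⁺ y (dist G′ p) + (min⁺ y (dist G p) - d (site φ) p) ₊ ≤ min⁺ y (dist G p)
  min⁺-dist-bid y p {G} {G′} {φ} G⊆G′ φ∈G′ = begin
    new + (old - δ) ₊   ≤⟨ +-monoʳ-≤ new (₊-lub drop (x≤y⇒0≤y-x new≤old)) ⟩
    new + (old - new)   ≈⟨ trans (+-comm _ _) (x-y+y≈x old new) ⟩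
    old                 ∎
    where
    open ≤-Reasoning
    new = min⁺ y (dist G′ p)
    old = min⁺ y (dist G p)
    δ = d (site φ) p
    new≤old : new ≤ old
    new≤old = min⁺-dist-antitone y p G⊆G′
    drop : old - δ ≤ old - new
    drop = x≤z+y⇒x-y≤z (linear (+-mono-≤ (min⁺-dist≤ y φ∈G′) (≤-reflexive (sym (x-y+y≈x old new))))
      (solve 4 (λ o δ n w → o :+ (δ :+ (w :+ n)) := (w :+ δ) :+ (n :+ o)) refl old δ new (old - new)))

-- The arrival of a request

module Arrivals {c ℓ₁ ℓ₂} {K : OrderedField c ℓ₁ ℓ₂} (E : Environment K) where
  open OrderedField K
  open OrderedFieldProperties K
  open Environment E
  open OMFLP E
  open Distances E

  module _ {n N} (rs : Vec Request n) (α : Vec Duals n) (F : Vec Facility N) (r : Request) where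
    open Arrival rs α F r

    data Sound (e : Commodity) (v : Carrier) : Status N → Set (c ⊔ ℓ₁ ⊔ ℓ₂) where
      unserved : Sound e v unserved
      existing : ∀ {i} → e ∈ demand r → d (site (lookup F i)) (location r) ≤ v → Sound e v (existing i)
      temp     : ∀ {m} → e ∈ demand r → Tight₃ (const v) e m → Sound e v (temp m)

    record Invariant (a : Duals) (st : Statuses) : Set (c ⊔ ℓ₁ ⊔ ℓ₂) where
      field
        0≤duals   : ∀ e → 0# ≤ a e
        -- Only a rise asserts that the constraints hold.
        respected : Respected a ⊎ (∀ e → a e ≡ 0#)
        sound     : ∀ e → Sound e (a e) (st e)

    data Ending : Outcome N → Set (c ⊔ ℓ₁ ⊔ ℓ₂) where
      reuse-large : ∀ {a st} i → Invariant a st → Tight₂ a i → Ending (outcome a ⁅ i ⁆ [])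
      open-large  : ∀ {a st} m → Invariant a st → Tight₄ a m →
                    Ending (outcome a none (⟨ m , full ⟩ ∷ []))
      all-small   : ∀ {a st} → Invariant a st → ¬ ∃ (Pending st) →
                    Ending (outcome a (⋃ (map (reusedBy ∘ st) (allFin ∣S∣)))
                                      (mapMaybe (openedFor st) (allFin ∣S∣)))

    open Invariant

    sound-updateAt : ∀ {a : Duals} {st : Statuses} e {s} → Sound e (a e) s → (∀ e → Sound e (a e) (st e)) →
      ∀ e′ → Sound e′ (a e′) (updateAt st e (const s) e′)
    sound-updateAt {a} {st} e {s} new old e′ with e′ ≟ e
    ... | yes ≡.refl = subst (Sound e (a e)) (≡.sym (updateAt-updates e st)) new
    ... | no  e′≢e   = subst (Sound e′ (a e′)) (≡.sym (updateAt-minimal e′ e st e′≢e)) (old e′)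

    ending : ∀ {a st o} → Process a st o → Invariant a st → Ending o
    ending {a} {st} (rise t 0≤t resp p) inv = ending p record
      { 0≤duals   = raise-nonNegative
      ; respected = inj₁ resp
      ; sound     = raise-sound
      }
      where
      raise-nonNegative : ∀ e → 0# ≤ raise t st a e
      raise-nonNegative e with lookup (demand r) e ∧ isUnserved (st e)
      ... | true  = +-nonNegative (0≤duals inv e) 0≤t
      ... | false = 0≤duals inv e
      raise-sound : ∀ e → Sound e (raise t st a e) (st e)
      raise-sound e with st e | sound inv e
      ... | unserved   | _ = unserved
      -- A served commodity does not grow: the guard of `raise` reduces to `false`.
      ... | existing _ | s rewrite Bool.∧-zeroʳ (lookup (demand r) e) = s
      ... | temp _     | s rewrite Bool.∧-zeroʳ (lookup (demand r) e) = s
    ending {a} (event₁ e i (e∈ , _) (_ , closest , tight) p) inv = ending p record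
      { 0≤duals   = 0≤duals inv
      ; respected = respected inv
      ; sound     = sound-updateAt {a} e (existing e∈ (≤-reflexive ([≈]-unique closest tight))) (sound inv)
      }
    ending {a} (event₃ e m (e∈ , _) tight p) inv = ending p record
      { 0≤duals   = 0≤duals inv
      ; respected = respected inv
      ; sound     = sound-updateAt {a} e (temp e∈ tight) (sound inv)
      }
    ending (event₂ i _ tight) inv = reuse-large i inv tight
    ending (event₄ m _ tight) inv = open-large m inv tight
    ending (finish none)      inv = all-small inv none

    served-ending : ∀ {o} → Served o → Ending o
    served-ending p = ending p record
      { 0≤duals   = λ _ → ≤-refl
      ; respected = inj₂ (λ _ → ≡.refl)
      ; sound     = λ _ → unserved
      }

    ending-nonNegative : ∀ {o} → Ending o → ∀ e → 0# ≤ duals o e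
    ending-nonNegative (reuse-large _ inv _) = 0≤duals inv
    ending-nonNegative (open-large _ inv _)  = 0≤duals inv
    ending-nonNegative (all-small inv _)     = 0≤duals inv

    ending-respected : ∀ {o} → Ending o → Respected (duals o) ⊎ (∀ e → duals o e ≡ 0#)
    ending-respected (reuse-large _ inv _) = respected inv
    ending-respected (open-large _ inv _)  = respected inv
    ending-respected (all-small inv _)     = respected inv

-- Dual feasibility

module ChargedRuns {c ℓ₁ ℓ₂} {K : OrderedField c ℓ₁ ℓ₂} (E : Environment K) where
  open OrderedField K
  open OrderedFieldProperties K
  open Environment E
  open OMFLP E
  open Distances E
  open Arrivals E

  Bidder : Set c
  Bidder = Carrier × Point

  surplus reach : Point → Bidder → Carrier
  surplus m (v , p) = v - d m p
  reach   m (v , p) = d m p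

  module At (m : Point) = Charging K (surplus m) (reach m)
  open At using (Charged; []; _∷_)

  -- This justifies the lower bound on bids in `Charged`. For every `φ` in `G`, a ≤ d(φ,p) ≤ d(φ,q)
  -- + d(q,m) + d(m,p), so the surplus of the new request minus d(m,q) is at most the distance from
  -- `q` to `G`. The surplus of the old request minus d(m,q) is at most `v`. The cap of the old
  -- request is therefore at least the smaller surplus minus d(m,q), and its bid subtracts d(m,q)
  -- once more.
  capped : ∀ m G {a p v q} → [ a ] ≤⁺ dist G p →
    (min (surplus m (v , q)) (surplus m (a , p)) - (d m q + d m q)) ₊ ≤ (min⁺ v (dist G q) - d m q) ₊
  capped m G {a} {p} {v} {q} a≤dist =
    ₊-lub (≤-trans (x+y≤z⇒x≤z-y (min⁺-glb ≤v (dist-glb G ≤dist))) (max≥ˡ _ 0#)) (0≤x₊ _)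
    where
    open ≤-Reasoning
    δ = d m q
    w = min (v - δ) (a - d m p) - (δ + δ)
    w+2δ : w + δ + δ ≤ min (v - δ) (a - d m p)
    w+2δ = ≤-reflexive (trans (+-assoc w δ δ) (x-y+y≈x _ (δ + δ)))
    ≤v : w + δ ≤ v
    ≤v = begin
      w + δ             ≤⟨ x≤x+y (0≤d) ⟩
      w + δ + δ         ≤⟨ w+2δ ⟩
      min _ _           ≤⟨ min≤ˡ (v - δ) _ ⟩
      v - δ             ≤⟨ x≤z+y⇒x-y≤z (x≤x+y (0≤d)) ⟩
      v                 ∎
    ≤dist : ∀ {φ} → φ List.∈ G → w + δ ≤ d (site φ) q
    ≤dist {φ} φ∈G = +-cancelʳ-≤ δ (begin
      w + δ + δ         ≤⟨ w+2δ ⟩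
      min _ _           ≤⟨ min≤ʳ _ (a - d m p) ⟩
      a - d m p         ≤⟨ x≤z+y⇒x-y≤z (begin
        a                                  ≤⟨ dist-lower a≤dist φ∈G ⟩
        d (site φ) p                       ≤⟨ d-triangle (site φ) m p ⟩
        d (site φ) m + d m p               ≤⟨ +-mono-≤ (d-triangle (site φ) q m) ≤-refl ⟩
        d (site φ) q + d q m + d m p       ≈⟨ +-congʳ (+-congˡ (d-sym q m)) ⟩
        d (site φ) q + δ + d m p           ∎) ⟩
      d (site φ) q + δ  ∎)

  module _ {n} (m : Point) (v : Fin n → Carrier) (q : Fin n → Point) (s : Fin n → Bool) where

    private
      bidders : List Bidder
      bidders = select s (λ j → v j , q j)

    -- The mask `t` marks the requests that bid in the constraint, `s` those that are kept; the
    -- other bids are nonnegative and may be dropped. The hypothesis on `dist` is constraint (1) or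
    -- (2), the next one is (3) or (4).
    charge : ∀ G {a p B} (t : Fin n → Bool) → (∀ j → s j ≡ true → t j ≡ true) →
      [ a ] ≤⁺ dist G p →
      (a - d m p) ₊ + sum (λ j → if t j then (min⁺ (v j) (dist G (q j)) - d m (q j)) ₊ else 0#) ≤ B →
      Charged m B bidders → Charged m B ((a , p) ∷ bidders)
    charge G {a} {p} t s⊆t a≤dist tight ch =
      ≤-trans (+-mono-≤ (max≥ˡ (a - d m p) 0#)
        (≤-trans (≤-reflexive (sumᴸ-select _ s _)) (sum-mono bid≤))) tight ∷ ch
      where
      bid≤ : ∀ j → (if s j then (min (surplus m (v j , q j)) (a - d m p) - (d m (q j) + d m (q j))) ₊ else 0#)
                 ≤ (if t j then (min⁺ (v j) (dist G (q j)) - d m (q j)) ₊ else 0#)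
      bid≤ j with s j | t j | s⊆t j
      ... | false | b     | _ = if-nonNegative b (0≤x₊ _)
      ... | true  | true  | _ = capped m G a≤dist
      ... | true  | false | h with () ← h ≡.refl

    -- Covers a request that was served without any rise, for which the constraints are not on
    -- record. Its surplus is nonpositive, so every minimum with it is too, and all positive parts
    -- vanish.
    charge-zero : ∀ {a p B} → a ≤ 0# → 0# ≤ B → Charged m B bidders → Charged m B ((a , p) ∷ bidders)
    charge-zero {a} {p} {B} a≤0 0≤B ch = (begin
      a - d m p + sumᴸ _ bidders    ≤⟨ +-mono-≤ a-δ≤0 (nonPositive bidders) ⟩
      0# + 0#                       ≈⟨ +-identityʳ 0# ⟩
      0#                            ≤⟨ 0≤B ⟩
      B                             ∎) ∷ ch
      where
      open ≤-Reasoning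
      a-δ≤0 : a - d m p ≤ 0#
      a-δ≤0 = x≤z+y⇒x-y≤z (≤-trans a≤0 (+-nonNegative ≤-refl (0≤d)))
      nonPositive : ∀ bs → sumᴸ (λ b → (min (surplus m b) (a - d m p) - (reach m b + reach m b)) ₊) bs ≤ 0#
      nonPositive []       = ≤-refl
      nonPositive (b ∷ bs) = ≤-trans (+-mono-≤
        (₊-lub (x≤z+y⇒x-y≤z (≤-trans (min≤ʳ (surplus m b) _)
          (≤-trans a-δ≤0 (≤-trans (+-nonNegative (0≤d) (0≤d)) (x≤y+x ≤-refl))))) ≤-refl)
        (nonPositive bs)) (≤-reflexive (+-identityʳ 0#))

  total-zero : ∀ r {a} → (∀ e → a e ≡ 0#) → total r a ≈ 0#
  total-zero r {a} a≡0 = sum-zero zero-term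
    where
    zero-term : ∀ e → (if lookup (demand r) e then a e else 0#) ≈ 0#
    zero-term e with lookup (demand r) e
    ... | true  = reflexive (a≡0 e)
    ... | false = refl

  -- Each arrival contributes the constraints (1) and (3) satisfied by its final duals, with the
  -- facilities open before it. The mask is arbitrary so that later only the requests which an
  -- offline facility serves are charged to it.
  small-charged : ∀ {n} {rs : Vec Request n} {α σ} → PD-OMFLP rs α σ → ∀ e m (s : Fin n → Bool) →
    (∀ j → s j ≡ true → lookup (demand (lookup rs j)) e ≡ true) →
    Charged m (f m ⁅ e ⁆) (select s (λ j → lookup α j e , location (lookup rs j)))
  small-charged start e m s s⊆ = []
  small-charged (arrive {rs = rs} {α} {σ} r {o} run srv) e m s s⊆
    with s zero in s₀ | small-charged run e m (s ∘ suc) (s⊆ ∘ suc)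
  ... | false | ih = ih
  ... | true  | ih with ending-respected rs α (facilities σ) r (served-ending rs α (facilities σ) r srv)
  ...   | inj₁ resp = charge m _ _ (s ∘ suc) (Arrival.offering rs α (facilities σ) r e) (λ j → lookup (demand (lookup rs j)) e) (s⊆ ∘ suc)
                        (constraint₁ e∈) (constraint₃ e∈ m) ih
    where
    open Arrival.Respected resp
    e∈ = lookup⇒[]= e (demand r) (s⊆ zero s₀)
  ...   | inj₂ zeros = charge-zero m _ _ (s ∘ suc) (≤-reflexive (reflexive (zeros e))) (0≤f m ⁅ e ⁆) ih

  large-charged : ∀ {n} {rs : Vec Request n} {α σ} → PD-OMFLP rs α σ → ∀ m (s : Fin n → Bool) →
    Charged m (f m full)
      (select s (λ j → total (lookup rs j) (lookup α j) , location (lookup rs j)))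
  large-charged start m s = []
  large-charged (arrive {rs = rs} {α} {σ} r run srv) m s
    with s zero | large-charged run m (s ∘ suc)
  ... | false | ih = ih
  ... | true  | ih with ending-respected rs α (facilities σ) r (served-ending rs α (facilities σ) r srv)
  ...   | inj₁ resp = charge m _ _ (s ∘ suc) (Arrival.large rs α (facilities σ) r) (const true) (λ _ _ → ≡.refl)
                        constraint₂ (constraint₄ m) ih
    where open Arrival.Respected resp
  ...   | inj₂ zeros = charge-zero m _ _ (s ∘ suc) (≤-reflexive (total-zero r zeros)) (0≤f m full) ih

  duals-nonNegative : ∀ {n} {rs : Vec Request n} {α σ} → PD-OMFLP rs α σ → ∀ j e → 0# ≤ lookup α j e
  duals-nonNegative (arrive {rs = rs} {α} {σ} r run srv) zero =
    ending-nonNegative rs α (facilities σ) r (served-ending rs α (facilities σ) r srv)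
  duals-nonNegative (arrive r run srv) (suc j) = duals-nonNegative run j

-- The cost of the algorithm

∈-mapMaybe : ∀ {a b} {A : Set a} {B : Set b} (k : A → Maybe B) {x y xs} →
  x List.∈ xs → k x ≡ just y → y List.∈ mapMaybe k xs
∈-mapMaybe k {xs = xs} x∈ eq = Any.mapMaybe⁺ k xs
  (Any.map⁺ (Any.map (λ { ≡.refl → subst (Maybe.Any _) (≡.sym eq) (Maybe.just ≡.refl) }) x∈))

-- Sums over subsets, lists and concatenations

module SubsetSums {c ℓ₁ ℓ₂} (K : OrderedField c ℓ₁ ℓ₂) where
  open OrderedField K
  open OrderedFieldProperties K

  sumOver-nonNegative : ∀ {n} (A : Subset n) {g} → (∀ i → 0# ≤ g i) → 0# ≤ sumOver A g
  sumOver-nonNegative A 0≤g = sum-nonNegative (λ i → if-nonNegative (lookup A i) (0≤g i))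

  sumOver-none : ∀ n g → sumOver {n} none g ≈ 0#
  sumOver-none zero    g = refl
  sumOver-none (suc n) g = trans (+-identityˡ _) (sumOver-none n (g ∘ suc))

  sumOver-full : ∀ n g → sumOver {n} full g ≈ sum g
  sumOver-full zero    g = refl
  sumOver-full (suc n) g = +-congˡ (sumOver-full n (g ∘ suc))

  sumOver-⁅⁆ : ∀ {n} (i : Fin n) g → sumOver ⁅ i ⁆ g ≈ g i
  sumOver-⁅⁆ {suc n} zero g = trans (+-congˡ (sumOver-none n (g ∘ suc))) (+-identityʳ _)
  sumOver-⁅⁆ (suc i)      g = trans (+-identityˡ _) (sumOver-⁅⁆ i (g ∘ suc))

  sumOver-∪ : ∀ {n} (A B : Subset n) {g} → (∀ i → 0# ≤ g i) → sumOver (A ∪ B) g ≤ sumOver A g + sumOver B g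
  sumOver-∪ []      []      0≤g = ≤-reflexive (sym (+-identityˡ 0#))
  sumOver-∪ (a ∷ A) (b ∷ B) {g} 0≤g = begin
    term (a ∨ b) + sumOver (A ∪ B) _ ≤⟨ +-mono-≤ (head a b) (sumOver-∪ A B (0≤g ∘ suc)) ⟩
    term a + term b + (sumOver A _ + sumOver B _) ≈⟨ solve 4 (λ a b c d → a :+ b :+ (c :+ d) := a :+ c :+ (b :+ d)) refl (term a) (term b) _ _ ⟩
    term a + sumOver A _ + (term b + sumOver B _) ∎
    where
    open ≤-Reasoning
    term : Bool → Carrier
    term b = if b then g zero else 0#
    head : ∀ a b → term (a ∨ b) ≤ term a + term b
    head true  b = x≤x+y (if-nonNegative b (0≤g zero))
    head false b = x≤y+x ≤-refl

  -- Only an inequality: a facility that serves several commodities of one request is connected once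
  -- but counted for each of them.
  sumOver-⋃ : ∀ {n} {A : Set} (h : A → Subset n) xs {g} → (∀ i → 0# ≤ g i) →
    sumOver (⋃ (map h xs)) g ≤ sumᴸ (λ x → sumOver (h x) g) xs
  sumOver-⋃ {n} h []       {g} 0≤g = ≤-reflexive (sumOver-none n g)
  sumOver-⋃     h (x ∷ xs) 0≤g =
    ≤-trans (sumOver-∪ (h x) (⋃ (map h xs)) 0≤g) (+-monoʳ-≤ _ (sumOver-⋃ h xs 0≤g))

  sumᴸ-tabulate : ∀ {a} {A : Set a} {n} (h : A → Carrier) (t : Fin n → A) →
    sumᴸ h (List.tabulate t) ≡ sum (h ∘ t)
  sumᴸ-tabulate {n = zero}  h t = ≡.refl
  sumᴸ-tabulate {n = suc n} h t = cong (h (t zero) +_) (sumᴸ-tabulate h (t ∘ suc))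

  sumᴸ-mapMaybe : ∀ {a b} {A : Set a} {B : Set b} (h : B → Carrier) (k : A → Maybe B) xs →
    sumᴸ h (mapMaybe k xs) ≈ sumᴸ (λ x → maybe h 0# (k x)) xs
  sumᴸ-mapMaybe h k []       = refl
  sumᴸ-mapMaybe h k (x ∷ xs) with k x
  ... | just y  = +-congˡ (sumᴸ-mapMaybe h k xs)
  ... | nothing = trans (sumᴸ-mapMaybe h k xs) (sym (+-identityˡ _))

  sum-fromList : ∀ {a} {A : Set a} (h : A → Carrier) xs → sum (h ∘ lookup (fromList xs)) ≡ sumᴸ h xs
  sum-fromList h []       = ≡.refl
  sum-fromList h (x ∷ xs) = cong (h x +_) (sum-fromList h xs)

  sum-++ : ∀ {a} {A : Set a} {m n} (h : A → Carrier) (xs : Vec A m) (ys : Vec A n) →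
    sum (h ∘ lookup (xs ++ ys)) ≈ sum (h ∘ lookup xs) + sum (h ∘ lookup ys)
  sum-++ h []       ys = sym (+-identityˡ _)
  sum-++ h (x ∷ xs) ys = trans (+-congˡ (sum-++ h xs ys)) (sym (+-assoc _ _ _))

  sumOver-++ : ∀ {a} {A : Set a} {m n} (h : A → Carrier) (xs : Vec A m) (ys : Vec A n) X Y →
    sumOver (X ++ Y) (h ∘ lookup (xs ++ ys)) ≈ sumOver X (h ∘ lookup xs) + sumOver Y (h ∘ lookup ys)
  sumOver-++ h []       ys []      Y = sym (+-identityˡ _)
  sumOver-++ h (x ∷ xs) ys (b ∷ X) Y = trans (+-congˡ (sumOver-++ h xs ys X Y)) (sym (+-assoc _ _ _))

-- The potential argument

module CostBound {c ℓ₁ ℓ₂} {K : OrderedField c ℓ₁ ℓ₂} (E : Environment K) where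
  open OrderedField K
  open OrderedFieldProperties K
  open SubsetSums K
  open Environment E
  open OMFLP E
  open Distances E
  open Arrivals E

  construction : Facility → Carrier
  construction φ = f (site φ) (config φ)

  connection : Request → Facility → Carrier
  connection r φ = d (site φ) (location r)

  cost-extend : ∀ {n} (rs : Vec Request n) (σ : Solution n) r (o : Outcome (size σ)) →
    cost (r ∷ rs) (extend σ o) ≈
    cost rs σ + (sumᴸ construction (opened o) +
      (sumOver (reused o) (connection r ∘ lookup (facilities σ)) + sumᴸ (connection r) (opened o)))
  cost-extend {n} rs σ r o = trans (+-cong facility-cost (+-cong assignment-r assignment-rs))
    (solve 5 (λ C o u v A → (C :+ o) :+ ((u :+ v) :+ A) := (C :+ A) :+ (o :+ (u :+ v))) refl _ _ _ _ _)
    where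
    F = facilities σ
    O = fromList (opened o)
    facility-cost : sum (construction ∘ lookup (F ++ O)) ≈
                    sum (construction ∘ lookup F) + sumᴸ construction (opened o)
    facility-cost = trans (sum-++ construction F O) (+-congˡ (reflexive (sum-fromList construction (opened o))))
    assignment-r : assignmentCost (F ++ O) r (reused o ++ full) ≈
                   sumOver (reused o) (connection r ∘ lookup F) + sumᴸ (connection r) (opened o)
    assignment-r = trans (sumOver-++ (connection r) F O (reused o) full)
      (+-congˡ (trans (sumOver-full _ (connection r ∘ lookup O)) (reflexive (sum-fromList (connection r) (opened o)))))
    assignment-rs : sum (λ j → assignmentCost (F ++ O) (lookup rs j) (lookup (Vec.map (_++ none) (assigned σ)) j)) ≈
                    sum (λ j → assignmentCost F (lookup rs j) (lookup (assigned σ) j))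
    assignment-rs = sum-cong λ j → trans
      (reflexive (cong (assignmentCost (F ++ O) (lookup rs j)) (lookup-map j (_++ none) (assigned σ))))
      (trans (sumOver-++ (connection (lookup rs j)) F O (lookup (assigned σ) j) none)
        (trans (+-congˡ (sumOver-none _ (connection (lookup rs j) ∘ lookup O))) (+-identityʳ _)))

  offering : Commodity → List Facility → List Facility
  offering e = filter (λ φ → e ∈? config φ)

  large : List Facility → List Facility
  large = filter (λ φ → ≡-dec Bool._≟_ (config φ) full)

  -- The potential: Φˢ e counts the small and Φˡ the large bids before the distance
  -- to a point is subtracted.
  capˢ : Commodity → List Facility → Request → Duals → Carrier
  capˢ e G r a = min⁺ (a e) (dist (offering e G) (location r))

  capˡ : List Facility → Request → Duals → Carrier
  capˡ G r a = min⁺ (total r a) (dist (large G) (location r))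

  Φˢ : ∀ {n} → Vec Request n → Vec Duals n → List Facility → Commodity → Carrier
  Φˢ rs α G e = sum (λ j → if lookup (demand (lookup rs j)) e then capˢ e G (lookup rs j) (lookup α j) else 0#)

  Φˡ : ∀ {n} → Vec Request n → Vec Duals n → List Facility → Carrier
  Φˡ rs α G = sum (λ j → capˡ G (lookup rs j) (lookup α j))

  dualSum : ∀ {n} → Vec Request n → Vec Duals n → Carrier
  dualSum rs α = sum (λ j → total (lookup rs j) (lookup α j))

  module Growth {n N} (rs : Vec Request n) (α : Vec Duals n) (F : Vec Facility N) (r : Request)
                {G′ : List Facility} (F⊆ : ∀ {φ} → φ List.∈ toList F → φ List.∈ G′) where
    open Arrival rs α F r using (smallBids; largeBids)

    offering-⊆ : ∀ e {φ} → φ List.∈ offering e (toList F) → φ List.∈ offering e G′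
    offering-⊆ e φ∈ with ∈-filter⁻ (λ φ → e ∈? config φ) {xs = toList F} φ∈
    ... | φ∈F , e∈φ = ∈-filter⁺ (λ φ → e ∈? config φ) (F⊆ φ∈F) e∈φ

    large-⊆ : ∀ {φ} → φ List.∈ large (toList F) → φ List.∈ large G′
    large-⊆ φ∈ with ∈-filter⁻ (λ φ → ≡-dec Bool._≟_ (config φ) full) {xs = toList F} φ∈
    ... | φ∈F , φ-full = ∈-filter⁺ (λ φ → ≡-dec Bool._≟_ (config φ) full) (F⊆ φ∈F) φ-full

    Φˢ-antitone : ∀ e → Φˢ rs α G′ e ≤ Φˢ rs α (toList F) e
    Φˢ-antitone e = sum-mono λ j → if-mono (lookup (demand (lookup rs j)) e)
      (min⁺-dist-antitone (lookup α j e) (location (lookup rs j)) (offering-⊆ e))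

    Φˡ-antitone : Φˡ rs α G′ ≤ Φˡ rs α (toList F)
    Φˡ-antitone = sum-mono λ j →
      min⁺-dist-antitone (total (lookup rs j) (lookup α j)) (location (lookup rs j)) large-⊆

    -- `min⁺-dist-bid` summed over the earlier requests demanding `e`: what they bid towards a
    -- facility at `m` is released from the potential when it opens.
    Φˢ-bids : ∀ e m {σ} → e ∈ σ → ⟨ m , σ ⟩ List.∈ G′ →
      Φˢ rs α G′ e + smallBids e m ≤ Φˢ rs α (toList F) e
    Φˢ-bids e m {σ} e∈σ φ∈G′ = sum-+-≤ kept bid (λ j →
      if-+-≤ (lookup (demand (lookup rs j)) e)
        (min⁺-dist-bid (lookup α j e) (location (lookup rs j)) (offering-⊆ e)
          (∈-filter⁺ (λ φ → e ∈? config φ) φ∈G′ e∈σ)))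
      where
      kept bid : Fin n → Carrier
      kept j = if lookup (demand (lookup rs j)) e then capˢ e G′ (lookup rs j) (lookup α j) else 0#
      bid j = if lookup (demand (lookup rs j)) e
              then (capˢ e (toList F) (lookup rs j) (lookup α j) - d m (location (lookup rs j))) ₊ else 0#

    Φˡ-bids : ∀ m → ⟨ m , full ⟩ List.∈ G′ → Φˡ rs α G′ + largeBids m ≤ Φˡ rs α (toList F)
    Φˡ-bids m φ∈G′ = sum-+-≤ kept bid (λ j →
      min⁺-dist-bid (total (lookup rs j) (lookup α j)) (location (lookup rs j)) large-⊆
        (∈-filter⁺ (λ φ → ≡-dec Bool._≟_ (config φ) full) φ∈G′ ≡.refl))
      where
      kept bid : Fin n → Carrier
      kept j = capˡ G′ (lookup rs j) (lookup α j)
      bid j = (capˡ (toList F) (lookup rs j) (lookup α j) - d m (location (lookup rs j))) ₊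

  increment : ∀ {N} → Vec Facility N → Request → Outcome N → Carrier
  increment F r o = sumᴸ construction (opened o) +
    (sumOver (reused o) (connection r ∘ lookup F) + sumᴸ (connection r) (opened o))

  module Step {n N} (rs : Vec Request n) (α : Vec Duals n) (F : Vec Facility N) (r : Request) where
    open Arrival rs α F r
      using (Statuses; Respected; Tight₃; smallBids; largeBids; reusedBy; openedFor)

    next : Outcome N → List Facility
    next o = toList F List.++ opened o

    -- The amortised cost of one arrival. One copy of the dual total pays for connection and for
    -- construction net of the bids; each of the two others pays for the entry of the request into
    -- one of the potentials `Φˢ` and `Φˡ`.
    Bounded : Outcome N → Set ℓ₂
    Bounded o =
      increment F r o + (sum (Φˢ (r ∷ rs) (duals o ∷ α) (next o)) + Φˡ (r ∷ rs) (duals o ∷ α) (next o))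
      ≤ total r (duals o) + total r (duals o) + total r (duals o)
        + (sum (Φˢ rs α (toList F)) + Φˡ rs α (toList F))

    module _ (a : Duals) {O : List Facility} where
      open Growth rs α F r {toList F List.++ O} ∈-++⁺ˡ public

      private G = toList F List.++ O

      Φˢ-grows : sum (Φˢ (r ∷ rs) (a ∷ α) (toList F List.++ O)) ≤ total r a + sum (Φˢ rs α (toList F))
      Φˢ-grows = sum-≤-+ (λ e → if lookup (demand r) e then a e else 0#) (Φˢ rs α (toList F))
        (λ e → +-mono-≤ (if-mono (lookup (demand r) e) (min⁺≤ˡ (a e) (dist (offering e G) (location r)))) (Φˢ-antitone e))

      Φˡ-grows : Φˡ (r ∷ rs) (a ∷ α) (toList F List.++ O) ≤ total r a + Φˡ rs α (toList F)
      Φˡ-grows = +-mono-≤ (min⁺≤ˡ (total r a) (dist (large G) (location r))) Φˡ-antitone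

    reuse-large-bounded : ∀ a i → d (site (lookup F i)) (location r) ≤ total r a →
      Bounded (outcome a ⁅ i ⁆ [])
    reuse-large-bounded a i near = ≤-trans
      (+-mono-≤ (≤-reflexive (trans (+-identityˡ _) (trans (+-identityʳ _) (sumOver-⁅⁆ i (connection r ∘ lookup F)))))
        (+-mono-≤ (Φˢ-grows a) (Φˡ-grows a)))
      (≤-trans (+-mono-≤ near ≤-refl)
        (≤-reflexive (solve 3 (λ A S L → A :+ (A :+ S :+ (A :+ L)) := A :+ A :+ A :+ (S :+ L)) refl _ _ _)))

    -- Tightness of (4) makes construction plus connection equal to the dual total plus the bids,
    -- and the bids are returned by the fall of `Φˡ`. The request enters `Φˡ` with at most its
    -- distance to the new facility.
    open-large-bounded : ∀ a m → d m (location r) ≤ total r a →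
      (total r a - d m (location r)) ₊ + largeBids m ≈ f m full →
      Bounded (outcome a none (⟨ m , full ⟩ ∷ []))
    open-large-bounded a m near paid = begin
      increment F r o + (_ + (_ + L′))
        ≤⟨ +-mono-≤ (≤-reflexive (+-cong (+-identityʳ _) (trans (+-congʳ (sumOver-none N (connection r ∘ lookup F))) (trans (+-identityˡ _) (+-identityʳ _)))))
             (+-mono-≤ (Φˢ-grows a) (+-mono-≤ (min⁺-dist≤ A (large-member)) ≤-refl)) ⟩
      f m full + δ + (A + S + (δ + L′))
        -- As the duals have reached `m`, the positive part in the tight constraint is the plain
        -- difference A - δ.
        ≤⟨ +-mono-≤ (+-mono-≤ (≤-trans (≤-reflexive (sym paid)) (+-mono-≤ (₊-lub ≤-refl (x≤y⇒0≤y-x near)) ≤-refl)) ≤-refl) ≤-refl ⟩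
      A - δ + bids + δ + (A + S + (δ + L′))
        ≈⟨ solve 6 (λ w b δ A S L → w :+ b :+ δ :+ (A :+ S :+ (δ :+ L)) := (w :+ δ) :+ (δ :+ A :+ (S :+ (L :+ b)))) refl (A - δ) bids δ A S L′ ⟩
      (A - δ + δ) + (δ + A + (S + (L′ + bids)))
        ≤⟨ +-mono-≤ (≤-reflexive (x-y+y≈x A δ)) (+-mono-≤ (+-mono-≤ near ≤-refl) (+-monoʳ-≤ S (Φˡ-bids a m new))) ⟩
      A + (A + A + (S + L))
        ≈⟨ solve 3 (λ A S L → A :+ (A :+ A :+ (S :+ L)) := A :+ A :+ A :+ (S :+ L)) refl A S L ⟩
      A + A + A + (S + L) ∎
      where
      open ≤-Reasoning
      o = outcome a none (⟨ m , full ⟩ ∷ [])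
      A = total r a
      δ = d m (location r)
      bids = largeBids m
      S = sum (Φˢ rs α (toList F))
      L = Φˡ rs α (toList F)
      L′ = Φˡ rs α (next o)
      new : ⟨ m , full ⟩ List.∈ next o
      new = ∈-++⁺ʳ (toList F) (here ≡.refl)
      large-member : ⟨ m , full ⟩ List.∈ large (next o)
      large-member = ∈-filter⁺ (λ φ → ≡-dec Bool._≟_ (config φ) full) new ≡.refl

    module _ (a : Duals) (st : Statuses) (0≤a : ∀ e → 0# ≤ a e)
             (sound : ∀ e → Sound rs α F r e (a e) (st e)) where

      private
        O : List Facility
        O = mapMaybe (openedFor st) (allFin ∣S∣)

        o : Outcome N
        o = outcome a (⋃ (map (reusedBy ∘ st) (allFin ∣S∣))) O

        share : Commodity → Carrier
        share e = if lookup (demand r) e then a e else 0#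

        built linked joined : Commodity → Carrier
        built  e = maybe construction 0# (openedFor st e)
        linked e = sumOver (reusedBy (st e)) (connection r ∘ lookup F)
        joined e = maybe (connection r) 0# (openedFor st e)

        headˢ : Commodity → Carrier
        headˢ e = if lookup (demand r) e then capˢ e (next o) r a else 0#

      offered : ∀ {e m} → st e ≡ temp m → ⟨ m , ⁅ e ⁆ ⟩ List.∈ next o
      offered {e} {m} eq = ∈-++⁺ʳ (toList F) (∈-mapMaybe (openedFor st) (∈-allFin e) opens)
        where
        opens : openedFor st e ≡ just ⟨ m , ⁅ e ⁆ ⟩
        opens rewrite eq = ≡.refl

      -- A small facility for `e` is financed by bids for `e` alone, so each commodity can be
      -- balanced against its own `Φˢ`. Two copies of its share suffice, since `Φˡ` is accounted for
      -- once for the whole request.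
      commodity-bounded : ∀ e →
        built e + (linked e + joined e) + (headˢ e + Φˢ rs α (next o) e) ≤
        share e + share e + Φˢ rs α (toList F) e
      commodity-bounded e with st e in eq | sound e
      ... | unserved   | _ = begin
        0# + (sumOver none (connection r ∘ lookup F) + 0#) + (headˢ e + Φˢ rs α (next o) e)
          ≤⟨ +-mono-≤ (≤-reflexive (trans (+-identityˡ _) (trans (+-identityʳ _) (sumOver-none N (connection r ∘ lookup F)))))
               (+-mono-≤ (if-mono (lookup (demand r) e) (min⁺≤ˡ (a e) (dist (offering e (next o)) (location r)))) (Φˢ-antitone a e)) ⟩
        0# + (share e + Φˢ rs α (toList F) e)
          ≤⟨ +-mono-≤ (if-nonNegative (lookup (demand r) e) (0≤a e)) ≤-refl ⟩
        share e + (share e + Φˢ rs α (toList F) e)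
          ≈⟨ +-assoc _ _ _ ⟨
        share e + share e + Φˢ rs α (toList F) e ∎
        where open ≤-Reasoning
      ... | existing i | existing e∈ near rewrite []=⇒lookup e∈ = begin
        0# + (sumOver ⁅ i ⁆ (connection r ∘ lookup F) + 0#) + (capˢ e (next o) r a + Φˢ rs α (next o) e)
          ≤⟨ +-mono-≤ (≤-reflexive (trans (+-identityˡ _) (trans (+-identityʳ _) (sumOver-⁅⁆ i (connection r ∘ lookup F)))))
               (+-mono-≤ (min⁺≤ˡ (a e) (dist (offering e (next o)) (location r))) (Φˢ-antitone a e)) ⟩
        d (site (lookup F i)) (location r) + (a e + Φˢ rs α (toList F) e)
          ≤⟨ +-mono-≤ near ≤-refl ⟩
        a e + (a e + Φˢ rs α (toList F) e)
          ≈⟨ +-assoc _ _ _ ⟨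
        a e + a e + Φˢ rs α (toList F) e ∎
        where open ≤-Reasoning
      ... | temp m | temp e∈ (near , paid) rewrite []=⇒lookup e∈ = begin
        f m ⁅ e ⁆ + (sumOver none (connection r ∘ lookup F) + δ) + (capˢ e (next o) r a + Φ′)
          ≤⟨ +-mono-≤ (+-mono-≤ (≤-trans (≤-reflexive (sym paid)) (+-mono-≤ (₊-lub ≤-refl (x≤y⇒0≤y-x near)) ≤-refl))
                         (≤-reflexive (trans (+-congʳ (sumOver-none N (connection r ∘ lookup F))) (+-identityˡ δ))))
               (+-mono-≤ (min⁺-dist≤ (a e) (∈-filter⁺ (λ φ → e ∈? config φ) (offered eq) (x∈⁅x⁆ e))) ≤-refl) ⟩
        a e - δ + bids + δ + (δ + Φ′)
          ≈⟨ solve 4 (λ w b δ Φ → w :+ b :+ δ :+ (δ :+ Φ) := w :+ δ :+ δ :+ (Φ :+ b)) refl (a e - δ) bids δ Φ′ ⟩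
        a e - δ + δ + δ + (Φ′ + bids)
          ≤⟨ +-mono-≤ (+-mono-≤ (≤-reflexive (x-y+y≈x (a e) δ)) near) (Φˢ-bids a e m (x∈⁅x⁆ e) (offered eq)) ⟩
        a e + a e + Φˢ rs α (toList F) e ∎
        where
        open ≤-Reasoning
        δ = d m (location r)
        bids = smallBids e m
        Φ′ = Φˢ rs α (next o) e

      increment≤ : increment F r o ≤ sum (λ e → built e + (linked e + joined e))
      increment≤ = begin
        sumᴸ construction O + (sumOver (reused o) (connection r ∘ lookup F) + sumᴸ (connection r) O)
          ≤⟨ +-mono-≤ (≤-reflexive (per-commodity construction))
               (+-mono-≤ (≤-trans (sumOver-⋃ (reusedBy ∘ st) (allFin ∣S∣) (λ _ → 0≤d))
                            (≤-reflexive (reflexive (sumᴸ-tabulate linked (λ e → e)))))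
                         (≤-reflexive (per-commodity (connection r)))) ⟩
        sum built + (sum linked + sum joined)
          ≤⟨ +-monoʳ-≤ (sum built) (sum-+-≤ linked joined (λ _ → ≤-refl)) ⟩
        sum built + sum (λ e → linked e + joined e)
          ≤⟨ sum-+-≤ built (λ e → linked e + joined e) (λ _ → ≤-refl) ⟩
        sum (λ e → built e + (linked e + joined e)) ∎
        where
        open ≤-Reasoning
        per-commodity : ∀ h → sumᴸ h O ≈ sum (λ e → maybe h 0# (openedFor st e))
        per-commodity h = trans (sumᴸ-mapMaybe h (openedFor st) (allFin ∣S∣))
          (reflexive (sumᴸ-tabulate (λ e → maybe h 0# (openedFor st e)) (λ e → e)))

      all-small-bounded : Bounded o
      all-small-bounded = begin
        increment F r o + (sum Φ″ + Φˡ (r ∷ rs) (a ∷ α) (next o))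
          ≤⟨ +-mono-≤ increment≤ (+-monoʳ-≤ (sum Φ″) (Φˡ-grows a)) ⟩
        sum spent + (sum Φ″ + (A + L))
          ≈⟨ +-assoc _ _ _ ⟨
        sum spent + sum Φ″ + (A + L)
          ≤⟨ +-mono-≤ (sum-+-≤ spent Φ″ commodity-bounded) ≤-refl ⟩
        sum (λ e → share e + share e + Φˢ rs α (toList F) e) + (A + L)
          ≤⟨ +-mono-≤ (sum-≤-+ (λ e → share e + share e) (Φˢ rs α (toList F)) (λ _ → ≤-refl)) ≤-refl ⟩
        sum (λ e → share e + share e) + S + (A + L)
          ≤⟨ +-mono-≤ (+-mono-≤ (sum-≤-+ share share (λ _ → ≤-refl)) ≤-refl) ≤-refl ⟩
        A + A + S + (A + L)
          ≈⟨ solve 3 (λ A S L → A :+ A :+ S :+ (A :+ L) := A :+ A :+ A :+ (S :+ L)) refl A S L ⟩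
        A + A + A + (S + L) ∎
        where
        open ≤-Reasoning
        A = total r a
        S = sum (Φˢ rs α (toList F))
        L = Φˡ rs α (toList F)
        spent Φ″ : Commodity → Carrier
        spent e = built e + (linked e + joined e)
        Φ″ = Φˢ (r ∷ rs) (a ∷ α) (next o)

    ending-bounded : ∀ {o} → Ending rs α F r o → Bounded o
    ending-bounded (reuse-large {a} i _ (_ , closest , tight)) =
      reuse-large-bounded a i (≤-reflexive ([≈]-unique closest tight))
    ending-bounded (open-large {a} m _ (near , paid)) = open-large-bounded a m near paid
    ending-bounded (all-small {a} {st} inv _) =
      all-small-bounded a st (Invariant.0≤duals inv) (Invariant.sound inv)

  -- The bounds of the single arrivals telescope, starting from an empty potential.
  potential-bound : ∀ {n} {rs : Vec Request n} {α σ} → PD-OMFLP rs α σ →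
    cost rs σ + (sum (Φˢ rs α (toList (facilities σ))) + Φˡ rs α (toList (facilities σ)))
    ≤ dualSum rs α + dualSum rs α + dualSum rs α
  potential-bound start = ≤-reflexive (+-congˡ
    (trans (+-identityʳ _) (sum-zero {g = Φˢ [] [] []} (λ _ → refl))))
  potential-bound (arrive {rs = rs} {α} {σ} r {o} run srv)
    -- Turns the facility list of `extend σ o` into `next o`, the form in which one arrival was
    -- bounded.
    rewrite toList-++ (facilities σ) (fromList (opened o)) | toList∘fromList (opened o) = begin
    cost (r ∷ rs) (extend σ o) + P′                ≈⟨ +-congʳ (cost-extend rs σ r o) ⟩
    cost rs σ + increment F r o + P′               ≈⟨ +-assoc _ _ _ ⟩
    cost rs σ + (increment F r o + P′)             ≤⟨ +-monoʳ-≤ _ (ending-bounded (served-ending rs α F r srv)) ⟩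
    cost rs σ + (A + A + A + P)                    ≈⟨ solve 3 (λ C A P → C :+ (A :+ A :+ A :+ P) := A :+ A :+ A :+ (C :+ P)) refl (cost rs σ) A P ⟩
    A + A + A + (cost rs σ + P)                    ≤⟨ +-monoʳ-≤ _ (potential-bound run) ⟩
    A + A + A + (T + T + T)                        ≈⟨ solve 2 (λ A T → A :+ A :+ A :+ (T :+ T :+ T) := A :+ T :+ (A :+ T) :+ (A :+ T)) refl A T ⟩
    A + T + (A + T) + (A + T)                      ∎
    where
    open ≤-Reasoning
    F = facilities σ
    open Step rs α F r
    A = total r (duals o)
    T = dualSum rs α
    P = sum (Φˢ rs α (toList F)) + Φˡ rs α (toList F)
    P′ = sum (Φˢ (r ∷ rs) (duals o ∷ α) (next o)) + Φˡ (r ∷ rs) (duals o ∷ α) (next o)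

  cost≤3dualSum : ∀ {n} {rs : Vec Request n} {α σ} → PD-OMFLP rs α σ → (∀ j e → 0# ≤ lookup α j e) →
    cost rs σ ≤ dualSum rs α + dualSum rs α + dualSum rs α
  cost≤3dualSum {rs = rs} {α} {σ} run 0≤α = ≤-trans (x≤x+y (+-nonNegative 0≤Φˢ 0≤Φˡ)) (potential-bound run)
    where
    G = toList (facilities σ)
    0≤cap : ∀ {y} G′ p → 0# ≤ y → 0# ≤ min⁺ y (dist G′ p)
    0≤cap G′ p 0≤y = min⁺-glb 0≤y (dist-glb G′ (λ _ → 0≤d))
    0≤Φˢ : 0# ≤ sum (Φˢ rs α G)
    0≤Φˢ = sum-nonNegative {g = Φˢ rs α G} λ e → sum-nonNegative λ j →
      if-nonNegative (lookup (demand (lookup rs j)) e)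
        (0≤cap (offering e G) (location (lookup rs j)) (0≤α j e))
    0≤Φˡ : 0# ≤ Φˡ rs α G
    0≤Φˡ = sum-nonNegative λ j → 0≤cap (large G) (location (lookup rs j))
      (sumOver-nonNegative (demand (lookup rs j)) (0≤α j))

-- The comparison with an offline solution

sumOver-const : ∀ {c ℓ₁ ℓ₂} (K : OrderedField c ℓ₁ ℓ₂) → let open OrderedField K in
  ∀ {n} (A : Subset n) z → sumOver A (const z) ≈ fromℕ ∣ A ∣ * z
sumOver-const K []          z = sym (zeroˡ z)
  where open OrderedFieldProperties K
sumOver-const K (true  ∷ A) z = trans (+-congˡ (sumOver-const K A z)) (sym (suc-* ∣ A ∣ z))
  where open OrderedFieldProperties K
sumOver-const K (false ∷ A) z = trans (+-identityˡ _) (sumOver-const K A z)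
  where open OrderedFieldProperties K

∣p∣≡suc⇒Nonempty : ∀ {n k} {p : Subset n} → ∣ p ∣ ≡ suc k → Nonempty p
∣p∣≡suc⇒Nonempty {n} {p = p} eq with nonempty? p
... | yes nonempty = nonempty
... | no  empty with () ← ≡.trans (≡.sym eq) (≡.trans (cong ∣_∣ (Empty-unique empty)) (∣⊥∣≡0 n))

module Competitiveness {c ℓ₁ ℓ₂} {K : OrderedField c ℓ₁ ℓ₂} (E : Environment K) where
  open OrderedField K
  open OrderedFieldProperties K
  open HarmonicBounds K
  open SemiringMult (CommutativeRing.semiring commutativeRing) using ()
    renaming (_×_ to _·_; ×-congʳ to ·-congʳ; ×-assoc-* to ·-assoc-*)
  open SubsetSums K
  open Environment E
  open OMFLP E
  open Distances E
  open ChargedRuns E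
  open CostBound E using (dualSum; cost≤3dualSum)

  -- Averaging gives f S ≤ (|S| / |σ|) f σ, and |S| / |σ| ≤ s² / s = s. The inequality is proved
  -- multiplied by `s`, which is cancelled at the end.
  full≤ : ∀ m {σ k s} → ∣ σ ∣ ≡ suc k → s ≤ fromℕ ∣ σ ∣ → √ ∣S∣ ⊑ s → 1# ≤ s → f m full ≤ s * f m σ
  full≤ m {σ} {k} {s} eq s≤σ (0≤s , S≤s²) 1≤s = *-cancelˡ-≤ 0≤s s≉0 (begin
    s * f m full             ≤⟨ *-monoʳ-≤ (0≤f m full) s≤σ ⟩
    k′ * f m full            ≈⟨ *-comm _ _ ⟩
    f m full * k′            ≈⟨ *-identityʳ _ ⟨
    f m full * k′ * 1#       ≈⟨ *-congˡ (*-inverseʳ S≉0) ⟨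
    f m full * k′ * (N * N ⁻¹) ≈⟨ solve 4 (λ x k n i → x :* k :* (n :* i) := (k :* n) :* (x :* i)) refl (f m full) k′ N (N ⁻¹) ⟩
    k′ * N * (f m full * N ⁻¹) ≤⟨ *-monoˡ-≤ (*-nonNegative (fromℕ-nonNegative ∣ σ ∣) (fromℕ-nonNegative ∣S∣))
                                   (average m (∣p∣≡suc⇒Nonempty eq)) ⟩
    k′ * N * (f m σ * k′ ⁻¹) ≈⟨ solve 4 (λ x k n i → k :* n :* (x :* i) := (k :* i) :* (n :* x)) refl (f m σ) k′ N (k′ ⁻¹) ⟩
    k′ * k′ ⁻¹ * (N * f m σ) ≈⟨ trans (*-congʳ (*-inverseʳ k′≉0)) (*-identityˡ _) ⟩
    N * f m σ                ≤⟨ *-monoʳ-≤ (0≤f m σ) S≤s² ⟩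
    s * s * f m σ            ≈⟨ *-assoc s s _ ⟩
    s * (s * f m σ)          ∎)
    where
    open ≤-Reasoning
    N = fromℕ ∣S∣
    k′ = fromℕ ∣ σ ∣
    positive : ∀ {x} → 1# ≤ x → ¬ x ≈ 0#
    positive 1≤x x≈0 = 0<1 (≤-trans 1≤x (≤-reflexive x≈0))
    s≉0 : ¬ s ≈ 0#
    s≉0 = positive 1≤s
    1≤k′ : 1# ≤ k′
    1≤k′ = subst (λ j → 1# ≤ fromℕ j) (≡.sym eq) (1≤fromℕ-suc k)
    k′≉0 : ¬ k′ ≈ 0#
    k′≉0 = positive 1≤k′
    S≉0 : ¬ N ≈ 0#
    S≉0 = positive (≤-trans 1≤k′ (fromℕ-mono-≤ (∣p∣≤n σ)))

  -- For a nonempty set of commodities, s ≤ 1 would still give 1 ≤ |S| ≤ s² ≤ s.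
  1≤√ : ∀ {k s} → suc k ≤ⁿ ∣S∣ → √ ∣S∣ ⊑ s → 1# ≤ s
  1≤√ {k} {s} k<S (0≤s , S≤s²) with ≤-total 1# s
  ... | inj₁ 1≤s = 1≤s
  ... | inj₂ s≤1 = begin
    1#            ≤⟨ 1≤fromℕ-suc k ⟩
    fromℕ (suc k) ≤⟨ fromℕ-mono-≤ k<S ⟩
    fromℕ ∣S∣     ≤⟨ S≤s² ⟩
    s * s         ≤⟨ *-monoˡ-≤ 0≤s s≤1 ⟩
    s * 1#        ≈⟨ *-identityʳ s ⟩
    s             ∎
    where open ≤-Reasoning

  module _ {n} (2≤n : 2 ≤ⁿ n) (rs : Vec Request n) {α σ} (run : PD-OMFLP rs α σ)
           {s l} (√S≤s : √ ∣S∣ ⊑ s) (log≤l : log₂ n ⊑ l) where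

    private
      -- 5 l, because 2 l (B + 2 D) + D ≤ 5 l (B + D).
      κ = l + l + l + l + l
      0≤l : 0# ≤ l
      0≤l = ≤-trans 0≤1 (1≤log 2≤n log≤l)
      0≤κ : 0# ≤ κ
      0≤κ = +-nonNegative (+-nonNegative (+-nonNegative (+-nonNegative 0≤l 0≤l) 0≤l) 0≤l) 0≤l
      loc : Fin n → Point
      loc j = location (lookup rs j)

    -- Each value is its surplus plus its distance to `m`. The surpluses sum to at most `H` times B
    -- + 2 D, the distances to at most `D`.
    charged-bound : ∀ m (t : Fin n → Bool) (v : Fin n → Carrier) {B D} →
      0# ≤ B → sum (λ j → if t j then d m (loc j) else 0#) ≤ D →
      At.Charged m B (select t (λ j → v j , loc j)) →
      sum (λ j → if t j then v j else 0#) ≤ κ * (B + D)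
    charged-bound m t v {B} {D} 0≤B δ≤D ch = begin
      sum (λ j → if t j then v j else 0#)
        ≤⟨ sum-≤-+ (λ j → if t j then v j - δ j else 0#) (λ j → if t j then δ j else 0#) split ⟩
      sum (λ j → if t j then v j - δ j else 0#) + sum (λ j → if t j then δ j else 0#)
        ≤⟨ +-mono-≤ (≤-trans (≤-reflexive (sym (sumᴸ-select (surplus m) t bidder)))
             (At.charged-sum m (λ _ → 0≤d) (length bs) bs ≡.refl ch
               (≤-trans (≤-reflexive (sumᴸ-select (reach m) t bidder)) δ≤D))) δ≤D ⟩
      H (length bs) * (B + (D + D)) + D
        ≤⟨ +-mono-≤ (*-monoʳ-≤ (+-nonNegative 0≤B (+-nonNegative 0≤D 0≤D))
             (≤-trans (H-mono-≤ (length-select t bidder)) (H≤2log 2≤n log≤l)))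
             (≤-trans (≤-reflexive (sym (*-identityˡ D))) (*-monoʳ-≤ 0≤D (1≤log 2≤n log≤l))) ⟩
      (l + l) * (B + (D + D)) + l * D
        -- The left side is 2 l B + 5 l D; adding 3 l B completes it to 5 l (B + D).
        ≤⟨ x≤x+y (*-nonNegative (+-nonNegative 0≤l (+-nonNegative 0≤l 0≤l)) 0≤B) ⟩
      (l + l) * (B + (D + D)) + l * D + (l + (l + l)) * B
        ≈⟨ solve 3 (λ l B D → (l :+ l) :* (B :+ (D :+ D)) :+ l :* D :+ (l :+ (l :+ l)) :* B
                           := (l :+ l :+ l :+ l :+ l) :* (B :+ D)) refl l B D ⟩
      κ * (B + D) ∎
      where
      open ≤-Reasoning
      δ : Fin n → Carrier
      δ j = d m (loc j)
      bidder : Fin n → Bidder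
      bidder j = v j , loc j
      bs = select t bidder
      0≤D : 0# ≤ D
      0≤D = ≤-trans (sum-nonNegative (λ j → if-nonNegative (t j) 0≤d)) δ≤D
      split : ∀ j → (if t j then v j else 0#) ≤ (if t j then v j - δ j else 0#) + (if t j then δ j else 0#)
      split j with t j
      ... | true  = ≤-reflexive (sym (x-y+y≈x (v j) (δ j)))
      ... | false = ≤-reflexive (sym (+-identityʳ 0#))

    private
      0≤α : ∀ j e → 0# ≤ lookup α j e
      0≤α = duals-nonNegative run

    demanded : Fin n → Commodity → Carrier
    demanded j e = if lookup (demand (lookup rs j)) e then lookup α j e else 0#

    0≤demanded : ∀ j e → 0# ≤ demanded j e
    0≤demanded j e = if-nonNegative (lookup (demand (lookup rs j)) e) (0≤α j e)

    module _ (m : Point) (ς : Configuration) (t : Fin n → Bool) where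

      private
        D = sum (λ j → if t j then d m (loc j) else 0#)
        0≤D : 0# ≤ D
        0≤D = sum-nonNegative (λ j → if-nonNegative (t j) 0≤d)
        W : Fin n → Commodity → Carrier
        W j e = if t j then (if lookup ς e then demanded j e else 0#) else 0#

      -- The duals are charged to a hypothetical small facility for `e` at `m`, which costs no more
      -- than `ς` there. Only requests that demand `e` bid for it, hence the narrower mask `t′`.
      commodity-weight : ∀ e → e ∈ ς → sum (λ j → if t j then demanded j e else 0#) ≤ κ * (f m ς + D)
      commodity-weight e e∈ς = begin
        sum (λ j → if t j then demanded j e else 0#) ≤⟨ sum-mono {h = λ j → if t′ j then lookup α j e else 0#} merge ⟩
        sum (λ j → if t′ j then lookup α j e else 0#)
          ≤⟨ charged-bound m t′ (λ j → lookup α j e) (0≤f m ⁅ e ⁆) (sum-mono δ≤)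
               (small-charged run e m t′ demands) ⟩
        κ * (f m ⁅ e ⁆ + D) ≤⟨ *-monoˡ-≤ 0≤κ (+-mono-≤ (singleton m e∈ς) ≤-refl) ⟩
        κ * (f m ς + D) ∎
        where
        open ≤-Reasoning
        t′ : Fin n → Bool
        t′ j = t j ∧ lookup (demand (lookup rs j)) e
        merge : ∀ j → (if t j then demanded j e else 0#) ≤ (if t′ j then lookup α j e else 0#)
        merge j with t j
        ... | true  = ≤-refl
        ... | false = ≤-refl
        demands : ∀ j → t′ j ≡ true → lookup (demand (lookup rs j)) e ≡ true
        demands j with t j
        ... | true  = λ eq → eq
        ... | false = λ ()
        δ≤ : ∀ j → (if t′ j then d m (loc j) else 0#) ≤ (if t j then d m (loc j) else 0#)
        δ≤ j with t j
        ... | true  = ≤-trans (if-mono (lookup (demand (lookup rs j)) e) ≤-refl) (drop (lookup (demand (lookup rs j)) e))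
          where
          drop : ∀ b → (if b then d m (loc j) else 0#) ≤ d m (loc j)
          drop true  = ≤-refl
          drop false = 0≤d
        ... | false = ≤-refl

      -- Here the factor `s` is the number of commodities: construction and distances are charged in
      -- full for each of them.
      weight-small : fromℕ ∣ ς ∣ ≤ s → sum (λ j → sum (W j)) ≤ s * (κ * (f m ς + D))
      weight-small ς≤s = begin
        sum (λ j → sum (W j))                ≈⟨ ∑-comm W ⟩
        sum (λ e → sum (λ j → W j e))        ≤⟨ sum-mono column ⟩
        sumOver ς (const (κ * (f m ς + D)))  ≈⟨ sumOver-const K ς _ ⟩
        fromℕ ∣ ς ∣ * (κ * (f m ς + D))      ≤⟨ *-monoʳ-≤ (*-nonNegative 0≤κ (+-nonNegative (0≤f m ς) 0≤D)) ς≤s ⟩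
        s * (κ * (f m ς + D))                ∎
        where
        open ≤-Reasoning
        column : ∀ e → sum (λ j → W j e) ≤ (if lookup ς e then κ * (f m ς + D) else 0#)
        column e with lookup ς e in eq
        ... | true  = commodity-weight e (lookup⇒[]= e ς eq)
        ... | false = ≤-reflexive (sum-zero none-weighed)
          where
          none-weighed : ∀ j → (if t j then 0# else 0#) ≈ 0#
          none-weighed j with t j
          ... | true  = refl
          ... | false = refl

      -- Here the factor `s` is the price of enlarging `ς` to all of S; the charge is then made only
      -- once, against a large facility at `m`.
      weight-large : ∀ {k} → ∣ ς ∣ ≡ suc k → s ≤ fromℕ ∣ ς ∣ → sum (λ j → sum (W j)) ≤ s * (κ * (f m ς + D))
      weight-large {k} eq s≤ς = begin
        sum (λ j → sum (W j))                ≤⟨ sum-mono row ⟩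
        sum (λ j → if t j then total (lookup rs j) (lookup α j) else 0#)
          ≤⟨ charged-bound m t (λ j → total (lookup rs j) (lookup α j)) (0≤f m full) ≤-refl (large-charged run m t) ⟩
        κ * (f m full + D)                   ≤⟨ *-monoˡ-≤ 0≤κ (+-mono-≤ (full≤ m eq s≤ς √S≤s 1≤s)
                                                  (≤-trans (≤-reflexive (sym (*-identityˡ D))) (*-monoʳ-≤ 0≤D 1≤s))) ⟩
        κ * (s * f m ς + s * D)              ≈⟨ solve 4 (λ κ s f D → κ :* (s :* f :+ s :* D) := s :* (κ :* (f :+ D))) refl κ s (f m ς) D ⟩
        s * (κ * (f m ς + D))                ∎
        where
        open ≤-Reasoning
        1≤s : 1# ≤ s
        1≤s = 1≤√ {k} (subst (_≤ⁿ ∣S∣) eq (∣p∣≤n ς)) √S≤s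
        row : ∀ j → sum (W j) ≤ (if t j then total (lookup rs j) (lookup α j) else 0#)
        row j with t j
        ... | true  = sum-mono λ e → drop e (lookup ς e)
          where
          drop : ∀ e b → (if b then demanded j e else 0#) ≤ demanded j e
          drop e true  = ≤-refl
          drop e false = 0≤demanded j e
        ... | false = ≤-reflexive (sum-replicate-zero ∣S∣)

      weight-bound : sum (λ j → sum (W j)) ≤ s * (κ * (f m ς + D))
      weight-bound with ∣ ς ∣ in eq
      -- The averaging condition concerns nonempty configurations, so the empty one is put with the
      -- small ones.
      ... | zero = weight-small (≤-trans (≤-reflexive (reflexive (cong fromℕ eq))) (proj₁ √S≤s))
      ... | suc k with ≤-total (fromℕ ∣ ς ∣) s
      ...   | inj₁ ς≤s = weight-small ς≤s
      ...   | inj₂ s≤ς = weight-large eq s≤ς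

    module _ {τ : Solution n} (feasible : Feasible rs τ) where

      private
        g : Fin (size τ) → Facility
        g i = lookup (facilities τ) i
        t : Fin (size τ) → Fin n → Bool
        t i j = lookup (lookup (assigned τ) j) i
        W : Fin (size τ) → Fin n → Commodity → Carrier
        W i j e = if t i j then (if lookup (config (g i)) e then demanded j e else 0#) else 0#
        D : Fin (size τ) → Carrier
        D i = sum (λ j → if t i j then d (site (g i)) (loc j) else 0#)
        share : Fin (size τ) → Carrier
        share i = f (site (g i)) (config (g i)) + D i

      -- Feasibility provides a facility of `τ` that serves `e` to request `j`, and the term of this
      -- facility is already the whole dual value.
      covered : ∀ j e → demanded j e ≤ sum (λ i → W i j e)
      covered j e with lookup (demand (lookup rs j)) e in eq
      ... | false = sum-nonNegative {g = λ i → if t i j then (if lookup (config (g i)) e then 0# else 0#) else 0#}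
                      λ i → if-nonNegative (t i j) (if-nonNegative (lookup (config (g i)) e) ≤-refl)
      ... | true with feasible j (lookup⇒[]= e (demand (lookup rs j)) eq)
      ...   | i , i∈ , e∈ = ≤-trans (≤-reflexive (reflexive (≡.sym value))) (term≤sum V 0≤V i)
        where
        V : Fin (size τ) → Carrier
        V i = if t i j then (if lookup (config (g i)) e then lookup α j e else 0#) else 0#
        0≤V : ∀ i → 0# ≤ V i
        0≤V i = if-nonNegative (t i j) (if-nonNegative (lookup (config (g i)) e) (0≤α j e))
        value : V i ≡ lookup α j e
        value rewrite []=⇒lookup i∈ | []=⇒lookup e∈ = ≡.refl

      cost≈ : cost rs τ ≈ sum share
      cost≈ = trans (+-congˡ (∑-comm (λ j i → if t i j then d (site (g i)) (loc j) else 0#)))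
        (sym (∑-distrib-+ (λ i → f (site (g i)) (config (g i))) D))

      dualSum-bound : dualSum rs α ≤ s * κ * cost rs τ
      dualSum-bound = begin
        sum (λ j → sum (demanded j))                        ≤⟨ sum-mono (λ j → sum-mono {h = λ e → sum (λ i → W i j e)} (covered j)) ⟩
        sum (λ j → sum (λ e → sum (λ i → W i j e)))         ≈⟨ sum-cong (λ j → ∑-comm (λ e i → W i j e)) ⟩
        sum (λ j → sum (λ i → sum (W i j)))                 ≈⟨ ∑-comm (λ j i → sum (W i j)) ⟩
        sum (λ i → sum (λ j → sum (W i j)))                 ≤⟨ sum-mono (λ i → weight-bound (site (g i)) (config (g i)) (t i)) ⟩
        sum (λ i → s * (κ * share i))                       ≈⟨ sum-cong (λ i → *-assoc s κ (share i)) ⟨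
        sum (λ i → s * κ * share i)                         ≈⟨ *-distribˡ-sum (s * κ) share ⟨
        s * κ * sum share                                   ≈⟨ *-congˡ cost≈ ⟨
        s * κ * cost rs τ                                   ∎
        where open ≤-Reasoning

      competitive : cost rs σ ≤ fromℕ 15 * (s * l) * cost rs τ + 0#
      competitive = begin
        cost rs σ                     ≤⟨ cost≤3dualSum run 0≤α ⟩
        T + T + T                     ≤⟨ +-mono-≤ (+-mono-≤ dualSum-bound dualSum-bound) dualSum-bound ⟩
        s * κ * C + s * κ * C + s * κ * C
          ≈⟨ solve 3 (λ s l C → let sκC = s :* (l :+ l :+ l :+ l :+ l) :* C in
               sκC :+ sκC :+ sκC := copies 15 (s :* l) :* C) refl s l C ⟩
        15 · (s * l) * C              ≈⟨ *-congʳ (·-congʳ 15 (*-identityˡ (s * l))) ⟨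
        15 · (1# * (s * l)) * C       ≈⟨ *-congʳ (·-assoc-* 15 1# (s * l)) ⟨
        fromℕ 15 * (s * l) * C        ≈⟨ +-identityʳ _ ⟨
        fromℕ 15 * (s * l) * C + 0#   ∎
        where
        open ≤-Reasoning
        -- The solver's counterpart of the multiple `15 · (s * l)`, to which it evaluates.
        copies : ∀ {k} → ℕ → Polynomial k → Polynomial k
        copies zero    p = con 0
        copies (suc k) p = p :+ copies k p
        T = dualSum rs α
        C = cost rs τ

theorem4 : ∀ {c ℓ₁ ℓ₂} (K : OrderedField c ℓ₁ ℓ₂) →
    let open OrderedField K in
    ∃ λ (C : ℕ) → ∃ λ (a : Carrier) →
    ∀ (E : Environment K) →
    let open Environment E
        open OMFLP E in
    ∀ {n} → 2 ≤ⁿ n → (rs : Vec Request n) →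
    ∀ {α σ} → PD-OMFLP rs α σ →
    ∀ {s l} → √ ∣S∣ ⊑ s → log₂ n ⊑ l →
    ∀ {τ} → Feasible rs τ →
    cost rs σ ≤ fromℕ C * (s * l) * cost rs τ + a
-- 15 = 3 · 5: the cost is at most three times the dual sum, and the charging loses 5 l besides `s`.
-- The additive constant is zero.
theorem4 K = 15 , OrderedField.0# K , λ E 2≤n rs run √S≤s log≤l {τ} feasible →
  Competitiveness.competitive E 2≤n rs run √S≤s log≤l {τ} feasible
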